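{- Let $r$ and $d$ be positive integers, let $\operatorname{Tv}(d,r)=(d+1)(r-1)+1$, and let $S\subset\mathbb{R}^d$ be a finite set of at least $3\operatorname{Tv}(d,r)-1$ points. Then the Tverberg $r$-partition graph $G_T[S,r]$ is connected.
   Context: A partition of a finite set $S$ into $r$ parts is a collection of $r$ nonempty pairwise disjoint subsets $P_1,\dots,P_r$ (unordered) whose union is $S$. For a finite $S\subset\mathbb{R}^d$, a Tverberg partition of $S$ into $r$ parts is a partition $P_1,\dots,P_r$ of $S$ into $r$ parts with $\bigcap_{j=1}^r\operatorname{conv}(P_j)\neq\emptyset$. For two partitions $P,P'$ of $S$, the partition distance $D(P,P')$ is the minimum number of elements of $S$ that must be removed so that $P$ and $P'$ restricted to the remaining elements coincide (equivalently, the minimum number of elements that must be moved from one part to another to transform $P$ into $P'$). The Tverberg $r$-partition graph $G_T[S,r]$ has as vertices all Tverberg partitions of $S$ into $r$ parts, with an edge between $P$ and $P'$ if and only if $D(P,P')=1$. -}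

module Defs where

open import Algebra.Bundles using (CommutativeRing)
import Algebra.Properties.CommutativeMonoid.Sum as CMSum
open import Data.Fin using (Fin)
open import Data.Fin.Subset using (Subset; _∈_; _∉_; _∩_; _─_; ∣_∣; Nonempty; Empty)
open import Data.Nat using (ℕ; _+_; _*_; _∸_)
import Data.Nat as ℕ
open import Data.Nat.Properties using (≤⇒≯; n<1+n)
import Data.Fin.Subset as Subset
open import Data.Fin.Subset.Properties using (∣⊥∣≡0)
open import Data.Product using (Σ; ∃; ∃-syntax; _×_; _,_; proj₁; proj₂; swap)
open import Level using (Level; _⊔_; suc; 0ℓ)
open import Relation.Binary using (Rel; Setoid; Symmetric; IsStrictTotalOrder; IsEquivalence)
import Relation.Binary.Construct.On as On
import Relation.Binary.Construct.StrictToNonStrict as ToNonStrict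
open import Relation.Binary.PropositionalEquality using (_≡_; _≢_; refl; sym; trans; cong; subst)
open import Relation.Nullary using (¬_)

-- The standard library has no real numbers, so ℝ enters axiomatically, as a
-- Dedekind-complete ordered field; classically this determines ℝ up to
-- isomorphism.  IsStrictTotalOrder includes trichotomy.
record CompleteOrderedField c ℓ₁ ℓ₂ : Set (suc (c ⊔ ℓ₁ ⊔ ℓ₂)) where
  infix 4 _<_ _≤_
  field
    commutativeRing : CommutativeRing c ℓ₁

  open CommutativeRing commutativeRing public
    renaming (_+_ to _+ᴿ_; _*_ to _*ᴿ_)

  field
    _<_                : Rel Carrier ℓ₂
    isStrictTotalOrder : IsStrictTotalOrder _≈_ _<_
    0<1                : 0# < 1#
    +-monoˡ-<          : ∀ {x y} z → x < y → x +ᴿ z < y +ᴿ z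
    *-pos              : ∀ {x y} → 0# < x → 0# < y → 0# < x *ᴿ y
    inverse            : ∀ x → ¬ (x ≈ 0#) → ∃[ y ] x *ᴿ y ≈ 1#

  _≤_ : Rel Carrier (ℓ₁ ⊔ ℓ₂)
  _≤_ = ToNonStrict._≤_ _≈_ _<_

  UpperBound : ∀ {p} → (Carrier → Set p) → Carrier → Set (c ⊔ ℓ₁ ⊔ ℓ₂ ⊔ p)
  UpperBound A u = ∀ x → A x → x ≤ u

  field
    supremum : (A : Carrier → Set (c ⊔ ℓ₁ ⊔ ℓ₂)) → ∃ A → ∃ (UpperBound A) →
               ∃[ s ] UpperBound A s × (∀ u → UpperBound A u → s ≤ u)

Tv : ℕ → ℕ → ℕ
Tv d r = (d + 1) * (r ∸ 1) + 1

------------------------------------------------------------------------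
-- Partitions of an n-element set

-- The parts carry labels in Fin r, which _≈ᴾ_ below forgets.
record Partition (n r : ℕ) : Set where
  field
    part     : Fin r → Subset n
    nonempty : ∀ j → Nonempty (part j)
    disjoint : ∀ i j → i ≢ j → Empty (part i ∩ part j)
    covers   : ∀ x → ∃[ j ] x ∈ part j

open Partition public

module _ {n r : ℕ} where

  infix 4 _≈ᴾ_

  -- Equality of the collections { P₁, …, Pᵣ } and { Q₁, …, Qᵣ }.
  _≈ᴾ_ : Rel (Partition n r) 0ℓ
  P ≈ᴾ Q = (∀ j → ∃[ k ] part P j ≡ part Q k)
         × (∀ k → ∃[ j ] part Q k ≡ part P j)

  -- The restriction of P to the complement of X consists of those sets
  -- Pⱼ ─ X that are nonempty.
  RestrictionsCoincide : Subset n → Rel (Partition n r) 0ℓ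
  RestrictionsCoincide X P Q = P ⊑ Q × Q ⊑ P
    where
    _⊑_ : Rel (Partition n r) 0ℓ
    P ⊑ Q = ∀ j → Nonempty (part P j ─ X) → ∃[ k ] part P j ─ X ≡ part Q k ─ X

  -- D(P,Q) = k, as the graph of the function D.
  Distance : Partition n r → Partition n r → ℕ → Set
  Distance P Q k = (∃[ X ] ∣ X ∣ ≡ k × RestrictionsCoincide X P Q)
                 × (∀ X → RestrictionsCoincide X P Q → k ℕ.≤ ∣ X ∣)

  ≈ᴾ-isEquivalence : IsEquivalence _≈ᴾ_
  ≈ᴾ-isEquivalence = record
    { refl  = (λ j → j , refl) , (λ j → j , refl)
    ; sym   = swap
    ; trans = λ (f , f′) (g , g′) → compose f g , compose g′ f′
    }
    where
    compose : {F G H : Fin r → Subset n} →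
              (∀ j → ∃[ k ] F j ≡ G k) → (∀ k → ∃[ l ] G k ≡ H l) →
              ∀ j → ∃[ l ] F j ≡ H l
    compose f g j with f j
    ... | k , e with g k
    ...   | l , e′ = l , trans e e′

  partitionSetoid : Setoid 0ℓ 0ℓ
  partitionSetoid = record { isEquivalence = ≈ᴾ-isEquivalence }

  coincide-resp : ∀ {X} {P P′ Q Q′ : Partition n r} → P ≈ᴾ P′ → Q ≈ᴾ Q′ →
                  RestrictionsCoincide X P Q → RestrictionsCoincide X P′ Q′
  coincide-resp {X} {P} {P′} {Q} {Q′} (p , p′) (q , q′) (f , g) =
    transport {part P} {part P′} {part Q} {part Q′} p′ q f ,
    transport {part Q} {part Q′} {part P} {part P′} q′ p g
    where
    transport : {F F′ G G′ : Fin r → Subset n} →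
                (∀ j → ∃[ k ] F′ j ≡ F k) → (∀ j → ∃[ k ] G j ≡ G′ k) →
                (∀ j → Nonempty (F j ─ X) → ∃[ k ] F j ─ X ≡ G k ─ X) →
                ∀ j → Nonempty (F′ j ─ X) → ∃[ k ] F′ j ─ X ≡ G′ k ─ X
    transport a b h j ne with a j
    ... | i , e with h i (subst (λ A → Nonempty (A ─ X)) e ne)
    ...   | k , e′ with b k
    ...     | l , e″ = l , trans (cong (_─ X) e) (trans e′ (cong (_─ X) e″))

  distance-resp : ∀ {P P′ Q Q′ : Partition n r} {k} → P ≈ᴾ P′ → Q ≈ᴾ Q′ →
                  Distance P Q k → Distance P′ Q′ k
  distance-resp {P} {P′} {Q} {Q′} p q ((X , e , c) , m) =
    (X , e , coincide-resp {X} {P} {P′} {Q} {Q′} p q c) ,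
    λ Y c′ → m Y (coincide-resp {Y} {P′} {P} {Q′} {Q} (swap p) (swap q) c′)

  distance-sym : ∀ {P Q : Partition n r} {k} → Distance P Q k → Distance Q P k
  distance-sym ((X , e , c) , m) = (X , e , swap c) , λ Y c′ → m Y (swap c′)

  distance-irrefl : ∀ {P Q : Partition n r} → P ≈ᴾ Q → ¬ Distance P Q 1
  distance-irrefl {P} {Q} p (_ , m) = ≤⇒≯ 1≤0 (n<1+n 0)
    where
    1≤0 : 1 ℕ.≤ 0
    1≤0 = subst (1 ℕ.≤_) (∣⊥∣≡0 n)
            (m Subset.⊥ (coincide-resp {Subset.⊥} {P} {P} {P} {Q}
              (IsEquivalence.refl ≈ᴾ-isEquivalence {P}) p
              ((λ j _ → j , refl) , (λ j _ → j , refl))))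

------------------------------------------------------------------------
-- Simple graphs whose vertices form a setoid

record Graph v e a : Set (suc (v ⊔ e ⊔ a)) where
  field
    vertices : Setoid v e
  open Setoid vertices public using () renaming (Carrier to Vertex; _≈_ to _≈ⱽ_)
  field
    _~_      : Rel Vertex a
    ~-sym    : Symmetric _~_
    ~-irrefl : ∀ {x y} → x ≈ⱽ y → ¬ (x ~ y)
    ~-resp   : ∀ {x x′ y y′} → x ≈ⱽ x′ → y ≈ⱽ y′ → x ~ y → x′ ~ y′

  data Walk : Rel Vertex (v ⊔ e ⊔ a) where
    stop : ∀ {x y} → x ≈ⱽ y → Walk x y
    step : ∀ {x y z} → x ~ y → Walk y z → Walk x z

-- The empty graph does not count as connected.
Connected : ∀ {v e a} → Graph v e a → Set (v ⊔ e ⊔ a)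
Connected G = Vertex × (∀ x y → Walk x y)
  where open Graph G

------------------------------------------------------------------------

module Tverberg {c ℓ₁ ℓ₂} (ℝ : CompleteOrderedField c ℓ₁ ℓ₂) where

  open CompleteOrderedField ℝ using (Carrier; _≈_; _≤_; _*ᴿ_; 0#; 1#; +-commutativeMonoid)
  open CMSum +-commutativeMonoid using (sum)

  Point : ℕ → Set c
  Point d = Fin d → Carrier

  -- A set of n points, given by an enumeration without repetition; its
  -- subsets and partitions are those of the index set Fin n.
  record PointSet (d n : ℕ) : Set (c ⊔ ℓ₁) where
    field
      point    : Fin n → Point d
      distinct : ∀ i j → (∀ k → point i k ≈ point j k) → i ≡ j

  open PointSet public

  module _ {d n : ℕ} (S : PointSet d n) where

    -- q is a convex combination of the points of S indexed by A.
    InConv : Subset n → Point d → Set (c ⊔ ℓ₁ ⊔ ℓ₂)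
    InConv A q = Σ (Fin n → Carrier) λ w →
        (∀ i → 0# ≤ w i)
      × (∀ i → i ∉ A → w i ≈ 0#)
      × sum w ≈ 1#
      × (∀ k → sum (λ i → w i *ᴿ point S i k) ≈ q k)

    IsTverberg : ∀ {r} → Partition n r → Set (c ⊔ ℓ₁ ⊔ ℓ₂)
    IsTverberg P = ∃[ q ] (∀ j → InConv (part P j) q)

    -- Vertices are compared as partitions, ignoring the witness of IsTverberg.
    tverbergGraph : ℕ → Graph (c ⊔ ℓ₁ ⊔ ℓ₂) 0ℓ 0ℓ
    tverbergGraph r = record
      { vertices = On.setoid (partitionSetoid {n} {r}) (proj₁ {B = IsTverberg})
      ; _~_      = λ (P , _) (Q , _) → Distance P Q 1
      ; ~-sym    = λ { {P , _} {Q , _} → distance-sym {P = P} {Q} }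
      ; ~-irrefl = λ { {P , _} {Q , _} → distance-irrefl {P = P} {Q} }
      ; ~-resp   = λ { {P , _} {P′ , _} {Q , _} {Q′ , _} →
                       distance-resp {P = P} {P′} {Q} {Q′} }
      }

{-# OPTIONS --safe #-}
module Submission where

-- Sarkaria's transformation assigns to a point p with label l the vector
-- (p , 1) ⊗ v l of a space of dimension N = (d + 1)(r - 1), where v 1 , … , v r
-- have (1 , … , 1) as their only linear dependence.  A labelling is a Tverberg
-- partition iff the vectors of the labelled points have the origin in their
-- convex hull.  The colourful Carathéodory theorem then gives Tverberg's theorem
-- for N + 1 = Tv(d,r) points, and the ordinary one shows that every Tverberg
-- partition has a witness supported on at most N + 1 points; the points outside
-- the support can be relabelled freely.  Given two Tverberg partitions with
-- supports A and B: if A and B are disjoint, relabel everything outside A as in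
-- the second partition, then A.  Otherwise |A ∪ B| ≤ 2 Tv(d,r) - 1, so the
-- remaining points contain a Tverberg partition of their own; install it, relabel
-- A ∪ B under its protection, then relabel the remaining points.
--
-- The colourful theorem is proved by minimising the distance to the origin.  The
-- minimum exists over any ordered field, because a closest point of a polytope is
-- found by linear algebra and induction on the faces.

open import Defs
open import Algebra.Bundles using (CommutativeMonoid; RawRing)
import Algebra.Properties.CommutativeSemigroup as CommutativeSemigroupProperties
import Algebra.Properties.Ring as RingProperties
import Algebra.Properties.Semiring.Mult as SemiringMult
import Algebra.Properties.Semiring.Sum as SemiringSum
import Algebra.Solver.Ring as RingSolver
open import Algebra.Solver.Ring.AlmostCommutativeRing
  using (fromCommutativeRing; _-Raw-AlmostCommutative⟶_)
open import Data.Bool using (true; false; if_then_else_)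
open import Data.Empty using (⊥-elim)
open import Data.Fin using (Fin; zero; suc; punchIn; punchOut; combine; remQuot; finToFun; funToFin)
open import Data.Fin.Properties
  using (any?; _≟_; punchIn-punchOut; punchOut-punchIn; punchInᵢ≢i; finToFun-funToFin; remQuot-combine)
open import Data.Fin.Subset using (Subset; _─_; ⁅_⁆; ∣_∣) renaming (_∈_ to _∈ˢ_; _∉_ to _∉ˢ_)
open import Data.Fin.Subset.Properties
  using (⊆-antisym; p─q⊆p; x∈p∧x∉q⇒x∈p─q; x∈⁅x⁆; x∈⁅y⁆⇒x≡y; x≢y⇒x∉⁅y⁆; ∣⁅x⁆∣≡1; nonempty?;
         p⊆q⇒∣p∣≤∣q∣; x∈p∩q⁻; x∈p∩q⁺)
open import Data.List using (List; []; _∷_; _++_; length; map; allFin)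
import Data.List.Membership.DecPropositional as DecMembership
open import Data.List.Membership.Propositional using (_∈_; _∉_; find; lose)
open import Data.List.Membership.Propositional.Properties
  using (∈-allFin; ∈-map⁺; ∈-++⁺ˡ; ∈-++⁺ʳ; ∈-++⁻; ∈-∃++)
open import Data.List.Properties using (length-map; length-tabulate; length-++)
import Data.List.Relation.Unary.Any as Any
open Any using (here; there)
open import Data.Maybe using (Maybe; just; nothing)
open import Data.Nat using (ℕ; zero; suc; z≤n; s≤s)
import Data.Nat as ℕ
import Data.Nat.Properties as ℕ
open import Data.Product using (∃; ∃-syntax; _×_; _,_; proj₁; proj₂; swap)
open import Data.Sum using (_⊎_; inj₁; inj₂; [_,_]′)
open import Data.Vec using (tabulate; here; there; _∷_)
open import Data.Vec.Functional using (insertAt; updateAt)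
open import Data.Vec.Functional.Properties
  using (insertAt-lookup; insertAt-punchIn; updateAt-updates; updateAt-minimal)
open import Data.Vec.Properties using (lookup∘tabulate; []=⇒lookup; lookup⇒[]=)
open import Function using (_∘_; case_of_; const; id)
open import Level using (0ℓ; _⊔_)
open import Relation.Binary using (IsStrictTotalOrder; Setoid; StrictTotalOrder; tri<; tri≈; tri>)
import Relation.Binary.Properties.StrictTotalOrder as StrictTotalOrderProperties
import Relation.Binary.PropositionalEquality as ≡
open ≡ using (_≡_; _≢_; _≗_)
import Relation.Binary.Reasoning.Setoid as SetoidReasoning
open import Relation.Nullary using (¬_; yes; no; does; ¬?)
open import Relation.Nullary.Decidable using (dec-true)

-- Arithmetic, order and finite sums in an ordered field.

module OrderedFieldProperties {c ℓ₁ ℓ₂} (ℝ : CompleteOrderedField c ℓ₁ ℓ₂) where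

  open CompleteOrderedField ℝ public hiding (zero)
    renaming (_+ᴿ_ to _+_; _*ᴿ_ to _*_)
  open RingProperties ring public using (-‿distribʳ-*; -‿distribˡ-*; -‿+-comm; -0#≈0#; -‿involutive)
  open SemiringSum semiring
    using (sum; sum-cong-≋; sum-replicate-zero; ∑-distrib-+; *-distribˡ-sum; ∑-comm; sum-remove)
  open SetoidReasoning setoid

  -- The ring solver only cancels opposite terms if it can decide equality of
  -- coefficients by computation, so its coefficients are formal differences
  -- m - n of natural numbers.
  private
    open CommutativeSemigroupProperties (CommutativeMonoid.commutativeSemigroup +-commutativeMonoid)
      using (interchange)
    open SemiringMult semiring using (×-homo-+; ×1-homo-*) renaming (_×_ to _·_)

    difference : ℕ × ℕ → Carrier
    difference (m , n) = m · 1# + - (n · 1#)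

    reduce : ℕ → ℕ → ℕ × ℕ
    reduce m n = m ℕ.∸ n , n ℕ.∸ m

    differences : RawRing 0ℓ 0ℓ
    differences = record
      { Carrier = ℕ × ℕ
      ; _≈_     = _≡_
      ; _+_     = λ (a , b) (c , d) → reduce (a ℕ.+ c) (b ℕ.+ d)
      ; _*_     = λ (a , b) (c , d) → reduce (a ℕ.* c ℕ.+ b ℕ.* d) (a ℕ.* d ℕ.+ b ℕ.* c)
      ; -_      = λ (a , b) → b , a
      ; 0#      = 0 , 0
      ; 1#      = 1 , 0
      }

    +-minus : ∀ a b c d → (a + c) + - (b + d) ≈ (a + - b) + (c + - d)
    +-minus a b c d = trans (+-congˡ (sym (-‿+-comm b d))) (interchange a c (- b) (- d))

    *-minus : ∀ a b c d → (a * c + b * d) + - (a * d + b * c) ≈ (a + - b) * (c + - d)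
    *-minus a b c d = begin
      (a * c + b * d) + - (a * d + b * c)         ≈⟨ +-minus (a * c) (a * d) (b * d) (b * c) ⟩
      (a * c + - (a * d)) + (b * d + - (b * c))   ≈⟨ +-cong (+-congˡ (-‿distribʳ-* a d)) lower ⟩
      (a * c + a * - d) + (- b * c + - b * - d)   ≈⟨ +-cong (distribˡ a c (- d)) (distribˡ (- b) c (- d)) ⟨
      a * (c + - d) + - b * (c + - d)             ≈⟨ distribʳ (c + - d) a (- b) ⟨
      (a + - b) * (c + - d)                       ∎
      where
      lower : b * d + - (b * c) ≈ - b * c + - b * - d
      lower = begin
        b * d + - (b * c)        ≈⟨ +-comm _ _ ⟩
        - (b * c) + b * d        ≈⟨ +-cong (-‿distribˡ-* b c) (sym (-‿involutive (b * d))) ⟩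
        - b * c + - (- (b * d))  ≈⟨ +-congˡ (-‿cong (-‿distribʳ-* b d)) ⟩
        - b * c + - (b * - d)    ≈⟨ +-congˡ (-‿distribˡ-* b (- d)) ⟩
        - b * c + - b * - d      ∎

    minus-swap : ∀ a b → b + - a ≈ - (a + - b)
    minus-swap a b = begin
      b + - a        ≈⟨ +-comm b (- a) ⟩
      - a + b        ≈⟨ +-congˡ (-‿involutive b) ⟨
      - a + - (- b)  ≈⟨ -‿+-comm a (- b) ⟩
      - (a + - b)    ∎

    ·-homo : ∀ a b c d → ((a ℕ.* b) ℕ.+ (c ℕ.* d)) · 1# ≈ (a · 1#) * (b · 1#) + (c · 1#) * (d · 1#)
    ·-homo a b c d = trans (×-homo-+ 1# (a ℕ.* b) (c ℕ.* d)) (+-cong (×1-homo-* a b) (×1-homo-* c d))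

    cross-equal : ∀ a b c d → a + d ≈ c + b → a + - b ≈ c + - d
    cross-equal a b c d eq = begin
      a + - b              ≈⟨ +-identityʳ _ ⟨
      (a + - b) + 0#       ≈⟨ +-congˡ (-‿inverseʳ d) ⟨
      (a + - b) + (d + - d) ≈⟨ interchange a (- b) d (- d) ⟩
      (a + d) + (- b + - d) ≈⟨ +-congʳ eq ⟩
      (c + b) + (- b + - d) ≈⟨ +-congˡ (+-comm (- b) (- d)) ⟩
      (c + b) + (- d + - b) ≈⟨ interchange c b (- d) (- b) ⟩
      (c + - d) + (b + - b) ≈⟨ +-congˡ (-‿inverseʳ b) ⟩
      (c + - d) + 0#       ≈⟨ +-identityʳ _ ⟩
      c + - d              ∎

    difference-cong : ∀ a b c d → a ℕ.+ d ≡ c ℕ.+ b → difference (a , b) ≈ difference (c , d)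
    difference-cong a b c d e = cross-equal _ _ _ _ (begin
      a · 1# + d · 1#   ≈⟨ ×-homo-+ 1# a d ⟨
      (a ℕ.+ d) · 1#    ≡⟨ ≡.cong (_· 1#) e ⟩
      (c ℕ.+ b) · 1#    ≈⟨ ×-homo-+ 1# c b ⟩
      c · 1# + b · 1#   ∎)

    ∸-exchange : ∀ m n → m ℕ.∸ n ℕ.+ n ≡ m ℕ.+ (n ℕ.∸ m)
    ∸-exchange zero    zero    = ≡.refl
    ∸-exchange zero    (suc n) = ≡.refl
    ∸-exchange (suc m) zero    = ≡.refl
    ∸-exchange (suc m) (suc n) = ≡.trans (ℕ.+-suc (m ℕ.∸ n) n) (≡.cong suc (∸-exchange m n))

    difference-reduce : ∀ m n → difference (reduce m n) ≈ difference (m , n)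
    difference-reduce m n = difference-cong (m ℕ.∸ n) (n ℕ.∸ m) m n (∸-exchange m n)

    morphism : differences -Raw-AlmostCommutative⟶ fromCommutativeRing commutativeRing
    morphism = record
      { ⟦_⟧    = difference
      ; +-homo = λ (a , b) (c , d) →
          trans (difference-reduce (a ℕ.+ c) (b ℕ.+ d))
              (trans (+-cong (×-homo-+ 1# a c) (-‿cong (×-homo-+ 1# b d))) (+-minus _ _ _ _))
      ; *-homo = λ (a , b) (c , d) →
          trans (difference-reduce (a ℕ.* c ℕ.+ b ℕ.* d) _)
              (trans (+-cong (·-homo a c b d) (-‿cong (·-homo a d b c))) (*-minus _ _ _ _))
      ; -‿homo = λ (a , b) → minus-swap _ _
      ; 0-homo = -‿inverseʳ 0#
      ; 1-homo = trans (+-congˡ -0#≈0#) (trans (+-identityʳ _) (+-identityʳ 1#))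
      }

    _≟ᵈ_ : ∀ x y → Maybe (difference x ≈ difference y)
    (a , b) ≟ᵈ (c , d) with (a ℕ.+ d) ℕ.≟ (c ℕ.+ b)
    ... | no _  = nothing
    ... | yes e = just (difference-cong a b c d e)

  open RingSolver differences (fromCommutativeRing commutativeRing) morphism _≟ᵈ_ public
    using (solve; _:=_; _:+_; _:*_; _:-_; :-_)

  private
    strictTotalOrder : StrictTotalOrder c ℓ₁ ℓ₂
    strictTotalOrder = record { isStrictTotalOrder = isStrictTotalOrder }

  open IsStrictTotalOrder isStrictTotalOrder public
    using (compare; _<?_; <-respʳ-≈; <-respˡ-≈)
    renaming (trans to <-trans; irrefl to <-irrefl; _≟_ to _≈?_)
  open StrictTotalOrderProperties strictTotalOrder public
    using () renaming (trans to ≤-trans; antisym to ≤-antisym; total to ≤-total)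

  ≤-refl : ∀ {x} → x ≤ x
  ≤-refl = inj₂ refl

  <-≤-trans : ∀ {x y z} → x < y → y ≤ z → x < z
  <-≤-trans x<y (inj₁ y<z) = <-trans x<y y<z
  <-≤-trans x<y (inj₂ y≈z) = <-respʳ-≈ y≈z x<y

  ≤-<-trans : ∀ {x y z} → x ≤ y → y < z → x < z
  ≤-<-trans (inj₁ x<y) y<z = <-trans x<y y<z
  ≤-<-trans (inj₂ x≈y) y<z = <-respˡ-≈ (sym x≈y) y<z

  ≮⇒≥ : ∀ {x y} → ¬ (x < y) → y ≤ x
  ≮⇒≥ {x} {y} x≮y with compare x y
  ... | tri< x<y _ _ = ⊥-elim (x≮y x<y)
  ... | tri≈ _ x≈y _ = inj₂ (sym x≈y)
  ... | tri> _ _ y<x = inj₁ y<x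

  ≤⇒≯ : ∀ {x y} → x ≤ y → ¬ (y < x)
  ≤⇒≯ x≤y y<x = <-irrefl refl (≤-<-trans x≤y y<x)

  x<y⇒0<y-x : ∀ {x y} → x < y → 0# < y - x
  x<y⇒0<y-x {x} x<y = <-respˡ-≈ (-‿inverseʳ x) (+-monoˡ-< (- x) x<y)

  0<y-x⇒x<y : ∀ {x y} → 0# < y - x → x < y
  0<y-x⇒x<y {x} {y} 0<y-x = <-respʳ-≈ (solve 2 (λ x y → (y :- x) :+ x := y) refl x y)
    (<-respˡ-≈ (+-identityˡ x) (+-monoˡ-< x 0<y-x))

  x≤y⇒0≤y-x : ∀ {x y} → x ≤ y → 0# ≤ y - x
  x≤y⇒0≤y-x (inj₁ x<y) = inj₁ (x<y⇒0<y-x x<y)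
  x≤y⇒0≤y-x {x} (inj₂ x≈y) = inj₂ (trans (sym (-‿inverseʳ x)) (+-congʳ x≈y))

  0≤y-x⇒x≤y : ∀ {x y} → 0# ≤ y - x → x ≤ y
  0≤y-x⇒x≤y (inj₁ 0<y-x) = inj₁ (0<y-x⇒x<y 0<y-x)
  0≤y-x⇒x≤y {x} {y} (inj₂ 0≈y-x) = inj₂ (begin
    x            ≈⟨ +-identityˡ x ⟨
    0# + x       ≈⟨ +-congʳ 0≈y-x ⟩
    (y - x) + x  ≈⟨ solve 2 (λ x y → (y :- x) :+ x := y) refl x y ⟩
    y            ∎)

  x-y≈0⇒x≈y : ∀ {x y} → x - y ≈ 0# → x ≈ y
  x-y≈0⇒x≈y {x} {y} e = begin
    x            ≈⟨ solve 2 (λ x y → x := (x :- y) :+ y) refl x y ⟩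
    (x - y) + y  ≈⟨ +-congʳ e ⟩
    0# + y       ≈⟨ +-identityˡ y ⟩
    y            ∎

  x<0⇒0<-x : ∀ {x} → x < 0# → 0# < - x
  x<0⇒0<-x {x} x<0 = <-respʳ-≈ (+-identityˡ (- x)) (x<y⇒0<y-x x<0)

  +-pos-nonneg : ∀ {x y} → 0# < x → 0# ≤ y → 0# < x + y
  +-pos-nonneg {x} {y} 0<x (inj₁ 0<y) = <-trans 0<y (<-respˡ-≈ (+-identityˡ y) (+-monoˡ-< y 0<x))
  +-pos-nonneg {x} {y} 0<x (inj₂ 0≈y) = <-respʳ-≈ (trans (sym (+-identityʳ x)) (+-congˡ 0≈y)) 0<x

  +-nonneg : ∀ {x y} → 0# ≤ x → 0# ≤ y → 0# ≤ x + y
  +-nonneg (inj₁ 0<x) 0≤y = inj₁ (+-pos-nonneg 0<x 0≤y)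
  +-nonneg {x} {y} (inj₂ 0≈x) 0≤y = ≤-trans 0≤y (inj₂ (trans (sym (+-identityˡ y)) (+-congʳ 0≈x)))

  *-nonneg : ∀ {x y} → 0# ≤ x → 0# ≤ y → 0# ≤ x * y
  *-nonneg (inj₁ 0<x) (inj₁ 0<y) = inj₁ (*-pos 0<x 0<y)
  *-nonneg {x} {y} (inj₁ _) (inj₂ 0≈y) = inj₂ (trans (sym (zeroʳ x)) (*-congˡ 0≈y))
  *-nonneg {x} {y} (inj₂ 0≈x) _ = inj₂ (trans (sym (zeroˡ y)) (*-congʳ 0≈x))

  square-pos : ∀ {x} → ¬ (x ≈ 0#) → 0# < x * x
  square-pos {x} x≉0 with compare x 0#
  ... | tri< x<0 _ _ = <-respʳ-≈ (solve 1 (λ x → (:- x) :* (:- x) := x :* x) refl x)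
                         (*-pos (x<0⇒0<-x x<0) (x<0⇒0<-x x<0))
  ... | tri≈ _ x≈0 _ = ⊥-elim (x≉0 x≈0)
  ... | tri> _ _ 0<x = *-pos 0<x 0<x

  square-nonneg : ∀ x → 0# ≤ x * x
  square-nonneg x with x ≈? 0#
  ... | yes x≈0 = inj₂ (sym (trans (*-congʳ x≈0) (zeroˡ x)))
  ... | no x≉0  = inj₁ (square-pos x≉0)

  0<⇒≉0 : ∀ {x} → 0# < x → ¬ (x ≈ 0#)
  0<⇒≉0 0<x x≈0 = <-irrefl (sym x≈0) 0<x

  positive-inverse : ∀ {x} → 0# < x → ∃[ y ] 0# < y × x * y ≈ 1#
  positive-inverse {x} 0<x with inverse x (0<⇒≉0 0<x)
  ... | y , xy≈1 = y , 0<y , xy≈1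
    where
    y≉0 : ¬ (y ≈ 0#)
    y≉0 y≈0 = 0<⇒≉0 0<1 (trans (sym xy≈1) (trans (*-congˡ y≈0) (zeroʳ x)))

    0<y : 0# < y
    0<y = <-respʳ-≈ (begin
      x * (y * y)  ≈⟨ *-assoc x y y ⟨
      (x * y) * y  ≈⟨ *-congʳ xy≈1 ⟩
      1# * y       ≈⟨ *-identityˡ y ⟩
      y            ∎) (*-pos 0<x (square-pos y≉0))

  *-cancel-≉0 : ∀ {x y} → ¬ (x ≈ 0#) → x * y ≈ 0# → y ≈ 0#
  *-cancel-≉0 {x} {y} x≉0 xy≈0 with inverse x x≉0
  ... | z , xz≈1 = begin
    y            ≈⟨ *-identityˡ y ⟨
    1# * y       ≈⟨ *-congʳ xz≈1 ⟨
    (x * z) * y  ≈⟨ solve 3 (λ x y z → (x :* z) :* y := (x :* y) :* z) refl x y z ⟩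
    (x * y) * z  ≈⟨ *-congʳ xy≈0 ⟩
    0# * z       ≈⟨ zeroˡ z ⟩
    0#           ∎

  -- Opaque, so that the length and the summand of a sum can be inferred by
  -- unification.
  opaque
    ∑ : ∀ {n} → (Fin n → Carrier) → Carrier
    ∑ = sum

    ∑≡sum : ∀ {n} (f : Fin n → Carrier) → ∑ f ≡ sum f
    ∑≡sum f = ≡.refl

    ∑-cong : ∀ {n} {f g : Fin n → Carrier} → (∀ i → f i ≈ g i) → ∑ f ≈ ∑ g
    ∑-cong = sum-cong-≋

    ∑-zero : ∀ {n} {f : Fin n → Carrier} → (∀ i → f i ≈ 0#) → ∑ f ≈ 0#
    ∑-zero {n} f≈0 = trans (sum-cong-≋ f≈0) (sum-replicate-zero n)

    ∑-+ : ∀ {n} (f g : Fin n → Carrier) → ∑ (λ i → f i + g i) ≈ ∑ f + ∑ g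
    ∑-+ = ∑-distrib-+

    ∑-*ˡ : ∀ {n} a (f : Fin n → Carrier) → ∑ (λ i → a * f i) ≈ a * ∑ f
    ∑-*ˡ a f = sym (*-distribˡ-sum a f)

    ∑-swap : ∀ {m n} (f : Fin m → Fin n → Carrier) →
             ∑ (λ i → ∑ (f i)) ≈ ∑ (λ j → ∑ (λ i → f i j))
    ∑-swap = ∑-comm

    ∑-remove : ∀ {n} i (f : Fin (suc n) → Carrier) → ∑ f ≈ f i + ∑ (f ∘ punchIn i)
    ∑-remove i = sum-remove {i = i}

    ∑-nonneg : ∀ {n} {f : Fin n → Carrier} → (∀ i → 0# ≤ f i) → 0# ≤ ∑ f
    ∑-nonneg {zero} 0≤f = ≤-refl
    ∑-nonneg {suc n} 0≤f = +-nonneg (0≤f zero) (∑-nonneg (0≤f ∘ suc))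

  ∑-linear : ∀ {n} a b (f g : Fin n → Carrier) → ∑ (λ i → a * f i + b * g i) ≈ a * ∑ f + b * ∑ g
  ∑-linear a b f g = trans (∑-+ _ _) (+-cong (∑-*ˡ a f) (∑-*ˡ b g))

  term≤∑ : ∀ {n} {f : Fin n → Carrier} → (∀ i → 0# ≤ f i) → ∀ i → f i ≤ ∑ f
  term≤∑ {suc n} {f} 0≤f i = 0≤y-x⇒x≤y (≤-trans (∑-nonneg (0≤f ∘ punchIn i)) (inj₂ (begin
    ∑ (f ∘ punchIn i)                ≈⟨ solve 2 (λ a b → b := (a :+ b) :- a) refl (f i) _ ⟩
    (f i + ∑ (f ∘ punchIn i)) - f i  ≈⟨ +-congʳ (∑-remove i f) ⟨
    ∑ f - f i                        ∎)))

  ∑-nonneg-zero : ∀ {n} {f : Fin n → Carrier} → (∀ i → 0# ≤ f i) → ∑ f ≤ 0# → ∀ i → f i ≈ 0#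
  ∑-nonneg-zero 0≤f s≤0 i = ≤-antisym (≤-trans (term≤∑ 0≤f i) s≤0) (0≤f i)

-- Linear dependences, and rays in the nonnegative orthant.

module LinearCombinations {c ℓ₁ ℓ₂} (ℝ : CompleteOrderedField c ℓ₁ ℓ₂) where

  open OrderedFieldProperties ℝ
  open SetoidReasoning setoid

  comb : ∀ {n m} → (Fin n → Carrier) → (Fin n → Fin m → Carrier) → Fin m → Carrier
  comb w x k = ∑ λ i → w i * x i k

  Nontrivial : ∀ {n} → (Fin n → Carrier) → Set ℓ₁
  Nontrivial c = ∃[ i ] ¬ (c i ≈ 0#)

  ∑-insertAt : ∀ {n} i v (w : Fin n → Carrier) (g : Fin (suc n) → Carrier) →
                 ∑ (λ j → insertAt w i v j * g j) ≈ v * g i + ∑ (λ j → w j * g (punchIn i j))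
  ∑-insertAt i v w g = trans (∑-remove i _)
    (+-cong (*-congʳ (reflexive (insertAt-lookup w i v)))
            (∑-cong (λ j → *-congʳ (reflexive (insertAt-punchIn w i v j)))))

  comb-linear : ∀ {n m} a b (v w : Fin n → Carrier) (x : Fin n → Fin m → Carrier) k →
                comb (λ i → a * v i + b * w i) x k ≈ a * comb v x k + b * comb w x k
  comb-linear a b v w x k = trans
    (∑-cong (λ i → solve 5 (λ a b v w y → (a :* v :+ b :* w) :* y := a :* (v :* y) :+ b :* (w :* y))
      refl a b (v i) (w i) (x i k)))
    (∑-linear a b _ _)

  -- Gaussian elimination: x p is used to clear the first coordinate.
  kernel : ∀ {m n} → m ℕ.< n → (x : Fin n → Fin m → Carrier) →
           ∃[ c ] Nontrivial c × (∀ k → comb c x k ≈ 0#)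
  kernel {zero} {suc n} _ x = (λ _ → 1#) , (zero , 0<⇒≉0 0<1) , λ ()
  kernel {suc m} {suc n} (s≤s m<n) x with any? (λ i → ¬? (x i zero ≈? 0#))
  ... | no all-zero = extend (kernel (ℕ.m<n⇒m<1+n m<n) (λ i → x i ∘ suc))
    where
    x₀≈0 : ∀ i → x i zero ≈ 0#
    x₀≈0 i with x i zero ≈? 0#
    ... | yes e = e
    ... | no ne = ⊥-elim (all-zero (i , ne))

    extend : _ → _
    extend (c , nt , eqs) = c , nt , λ where
      zero    → ∑-zero (λ i → trans (*-congˡ (x₀≈0 i)) (zeroʳ (c i)))
      (suc k) → eqs k
  ... | yes (p , xp≉0) = pivot (kernel m<n y)
    where
    a = x p zero

    y : Fin n → Fin m → Carrier
    y j k = a * x (punchIn p j) (suc k) - x (punchIn p j) zero * x p (suc k)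

    pivot : _ → _
    pivot (c , (j , cj≉0) , eqs) = c′ , (punchIn p j , c′≉0) , λ where
        zero    → trans (expand zero) (begin
          - s * a + ∑ (λ j → (a * c j) * x (punchIn p j) zero)   ≈⟨ +-congˡ (pull zero) ⟩
          - s * a + a * s                                          ≈⟨ solve 2 (λ s a → :- s :* a :+ a :* s := a :- a)
              refl s a ⟩
          a - a                                                    ≈⟨ -‿inverseʳ a ⟩
          0#                                                       ∎)
        (suc k) → trans (expand (suc k)) (begin
          - s * x p (suc k) + ∑ (λ j → (a * c j) * x (punchIn p j) (suc k))
            ≈⟨ +-congˡ (pull (suc k)) ⟩
          - s * x p (suc k) + a * S (suc k)
            ≈⟨ solve 4 (λ s b a t → :- s :* b :+ a :* t := a :* t :+ (:- b) :* s)
                refl s (x p (suc k)) a (S (suc k)) ⟩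
          a * S (suc k) + - x p (suc k) * s
            ≈⟨ ∑-linear a (- x p (suc k)) _ _ ⟨
          ∑ (λ j → a * (c j * x (punchIn p j) (suc k)) + - x p (suc k) * (c j * x (punchIn p j) zero))
            ≈⟨ ∑-cong (λ j → solve 5 (λ a c u b v → a :* (c :* u) :+ (:- b) :* (c :* v) := c :* (a :* u :- v :* b))
                 refl a (c j) (x (punchIn p j) (suc k)) (x p (suc k)) (x (punchIn p j) zero)) ⟩
          comb c y k
            ≈⟨ eqs k ⟩
          0# ∎)
      where
      S : Fin (suc m) → Carrier
      S k = ∑ (λ j → c j * x (punchIn p j) k)

      s = S zero
      -- The other terms contribute `a * s` to the first coordinate, and the entry `- s` at `p`
      -- cancels it. Scaling them by `a` takes the place of a division.
      c′ = insertAt (λ j → a * c j) p (- s)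

      expand : ∀ k → comb c′ x k ≈ - s * x p k + ∑ (λ j → (a * c j) * x (punchIn p j) k)
      expand k = ∑-insertAt p (- s) (λ j → a * c j) (λ i → x i k)

      pull : ∀ k → ∑ (λ j → (a * c j) * x (punchIn p j) k) ≈ a * S k
      pull k = trans (∑-cong (λ j → *-assoc a (c j) (x (punchIn p j) k)))
                     (∑-*ˡ a (λ j → c j * x (punchIn p j) k))

      c′≉0 : ¬ (c′ (punchIn p j) ≈ 0#)
      c′≉0 e = cj≉0 (*-cancel-≉0 xp≉0
        (trans (sym (reflexive (insertAt-punchIn (λ j → a * c j) p (- s) j))) e))

  negative-coordinate : ∀ {n} {c : Fin n → Carrier} → Nontrivial c → ∑ c ≈ 0# → ∃[ i ] c i < 0#
  negative-coordinate {c = c} (i , ci≉0) s≈0 with any? (λ j → c j <? 0#)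
  ... | yes neg = neg
  ... | no none = ⊥-elim (ci≉0 (∑-nonneg-zero (λ j → ≮⇒≥ (λ cj<0 → none (j , cj<0))) (inj₂ s≈0) i))

  private
    t-zero : ∀ {w c} → c < 0# → 0# ≤ w → ∃[ t ] 0# ≤ t × w + t * c ≈ 0#
    t-zero {w} {c} c<0 0≤w with positive-inverse (x<0⇒0<-x c<0)
    ... | y , 0<y , e = w * y , *-nonneg 0≤w (inj₁ 0<y) , (begin
      w + (w * y) * c    ≈⟨ solve 3 (λ w y c → w :+ (w :* y) :* c := w :- w :* ((:- c) :* y)) refl w y c ⟩
      w - w * (- c * y)  ≈⟨ +-congˡ (-‿cong (trans (*-congˡ e) (*-identityʳ w))) ⟩
      w - w              ≈⟨ -‿inverseʳ w ⟩
      0#                 ∎)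

    -- For `c < 0#` the value decreases in the parameter; otherwise it never drops below `w`.
    earlier : ∀ {w c t t′} → t′ ≤ t → 0# ≤ w → 0# ≤ t′ → 0# ≤ w + t * c → 0# ≤ w + t′ * c
    earlier {w} {c} {t} {t′} t′≤t 0≤w 0≤t′ h with c <? 0#
    ... | no c≮0 = +-nonneg 0≤w (*-nonneg 0≤t′ (≮⇒≥ c≮0))
    ... | yes c<0 = ≤-trans (+-nonneg h (*-nonneg (x≤y⇒0≤y-x t′≤t) (inj₁ (x<0⇒0<-x c<0))))
        (inj₂ (solve 4 (λ w t c s → (w :+ t :* c) :+ (t :- s) :* (:- c) := w :+ s :* c) refl w t c t′))

  -- The ray from w in direction c leaves the nonnegative orthant at parameter t.
  Exit : ∀ {n} (w c : Fin n → Carrier) → Set _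
  Exit w c = ∃[ t ] 0# ≤ t × (∀ i → 0# ≤ w i + t * c i) × ∃[ i ] w i + t * c i ≈ 0#

  exit : ∀ {n} (w c : Fin n → Carrier) → (∀ i → 0# ≤ w i) → (∃[ i ] c i < 0#) → Exit w c
  exit w c 0≤w (i , ci<0) with go w c 0≤w
    where
    -- The recursion does not know where a negative entry lies, hence the alternative. Of two
    -- candidate parameters the smaller is kept, where `earlier` preserves nonnegativity of the
    -- remaining coordinates.
    go : ∀ {n} (w c : Fin n → Carrier) → (∀ i → 0# ≤ w i) → (∀ i → 0# ≤ c i) ⊎ Exit w c
    go {zero} w c 0≤w = inj₁ (λ ())
    go {suc n} w c 0≤w with go (w ∘ suc) (c ∘ suc) (0≤w ∘ suc) | c zero <? 0#
    ... | inj₁ 0≤c | no c₀≮0 = inj₁ λ { zero → ≮⇒≥ c₀≮0 ; (suc i) → 0≤c i }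
    ... | inj₁ 0≤c | yes c₀<0 = let t , 0≤t , e = t-zero c₀<0 (0≤w zero) in inj₂
        (t , 0≤t , (λ { zero → inj₂ (sym e) ; (suc i) → +-nonneg (0≤w (suc i)) (*-nonneg 0≤t (0≤c i)) }) , zero , e)
    ... | inj₂ (t , 0≤t , h , i , e) | no c₀≮0 = inj₂
        (t , 0≤t , (λ { zero → +-nonneg (0≤w zero) (*-nonneg 0≤t (≮⇒≥ c₀≮0)) ; (suc j) → h j }) , suc i , e)
    ... | inj₂ (t , 0≤t , h , i , e) | yes c₀<0 with t-zero c₀<0 (0≤w zero)
    ...   | t′ , 0≤t′ , e′ with ≤-total t t′
    ...     | inj₁ t≤t′ = inj₂ (t , 0≤t , (λ where
                zero → earlier t≤t′ (0≤w zero) 0≤t (inj₂ (sym e′))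
                (suc j) → h j) , suc i , e)
    ...     | inj₂ t′≤t = inj₂ (t′ , 0≤t′ , (λ where
                zero → inj₂ (sym e′)
                (suc j) → earlier t′≤t (0≤w (suc j)) 0≤t′ (h j)) , zero , e′)
  ... | inj₁ 0≤c = ⊥-elim (≤⇒≯ (0≤c i) ci<0)
  ... | inj₂ ex = ex

-- Points of convex hulls closest to the origin.

module ConvexCombinations {c ℓ₁ ℓ₂} (ℝ : CompleteOrderedField c ℓ₁ ℓ₂) where

  open OrderedFieldProperties ℝ
  open LinearCombinations ℝ
  open SetoidReasoning setoid

  dot : ∀ {m} → (Fin m → Carrier) → (Fin m → Carrier) → Carrier
  dot u v = ∑ λ k → u k * v k

  norm² : ∀ {m} → (Fin m → Carrier) → Carrier
  norm² u = dot u u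

  dot-cong : ∀ {m} {u u′ v v′ : Fin m → Carrier} → (∀ k → u k ≈ u′ k) → (∀ k → v k ≈ v′ k) →
             dot u v ≈ dot u′ v′
  dot-cong e e′ = ∑-cong (λ k → *-cong (e k) (e′ k))

  dot-comb : ∀ {n m} (w : Fin n → Carrier) (x : Fin n → Fin m → Carrier) y →
             dot (comb w x) y ≈ ∑ λ i → w i * dot (x i) y
  dot-comb w x y = begin
    ∑ (λ k → ∑ (λ i → w i * x i k) * y k)    ≈⟨ ∑-cong (λ k → trans (*-comm _ (y k)) (sym (∑-*ˡ (y k) _))) ⟩
    ∑ (λ k → ∑ (λ i → y k * (w i * x i k)))  ≈⟨ ∑-swap _ ⟩
    ∑ (λ i → ∑ (λ k → y k * (w i * x i k)))  ≈⟨ ∑-cong (λ i → ∑-cong (λ k →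
        solve 3 (λ y w x → y :* (w :* x) := w :* (x :* y)) refl (y k) (w i) (x i k))) ⟩
    ∑ (λ i → ∑ (λ k → w i * (x i k * y k)))  ≈⟨ ∑-cong (λ i → ∑-*ˡ (w i) _) ⟩
    ∑ (λ i → w i * dot (x i) y)              ∎

  norm²-linear : ∀ {m} a b (u v : Fin m → Carrier) →
    norm² (λ k → a * u k + b * v k) ≈
    (a * a * norm² u + (a * b * dot u v + a * b * dot u v)) + b * b * norm² v
  norm²-linear a b u v = begin
    ∑ (λ k → (a * u k + b * v k) * (a * u k + b * v k))
      ≈⟨ ∑-cong (λ k → solve 4 (λ a b u v → (a :* u :+ b :* v) :* (a :* u :+ b :* v) :=
           (a :* a :* (u :* u) :+ (a :* b :* (u :* v) :+ a :* b :* (u :* v))) :+ b :* b :* (v :* v))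
           refl a b (u k) (v k)) ⟩
    ∑ (λ k → (a * a * (u k * u k) + (a * b * (u k * v k) + a * b * (u k * v k))) + b * b * (v k * v k))
      ≈⟨ ∑-+ _ _ ⟩
    ∑ (λ k → a * a * (u k * u k) + (a * b * (u k * v k) + a * b * (u k * v k))) + ∑ (λ k → b * b * (v k * v k))
      ≈⟨ +-cong (trans (∑-+ _ _) (+-cong (∑-*ˡ _ _) (∑-linear _ _ _ _))) (∑-*ˡ _ _) ⟩
    (a * a * norm² u + (a * b * dot u v + a * b * dot u v)) + b * b * norm² v ∎

  norm²-nonneg : ∀ {m} (u : Fin m → Carrier) → 0# ≤ norm² u
  norm²-nonneg u = ∑-nonneg (λ k → square-nonneg (u k))

  norm²-zero : ∀ {m} (u : Fin m → Carrier) → norm² u ≈ 0# → ∀ k → u k ≈ 0#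
  norm²-zero u e k with u k ≈? 0#
  ... | yes uk≈0 = uk≈0
  ... | no uk≉0 = ⊥-elim (0<⇒≉0 (square-pos uk≉0)
                    (∑-nonneg-zero (λ k → square-nonneg (u k)) (inj₂ e) k))

  norm²-difference : ∀ {m} (u v : Fin m → Carrier) → 0# ≤ (norm² u - (dot u v + dot u v)) + norm² v
  norm²-difference u v = ≤-trans (norm²-nonneg (λ k → 1# * u k + - 1# * v k)) (inj₂ (begin
    norm² (λ k → 1# * u k + - 1# * v k)
      ≈⟨ norm²-linear 1# (- 1#) u v ⟩
    (1# * 1# * U + (1# * - 1# * D + 1# * - 1# * D)) + - 1# * - 1# * V
      -- The solver sees `1#` as a variable `o`, so both sides are kept homogeneous in `o` and the
      -- remaining factors are removed afterwards.
      ≈⟨ solve 4 (λ o U D V → (o :* o :* U :+ (o :* (:- o) :* D :+ o :* (:- o) :* D)) :+ (:- o) :* (:- o) :* V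
           := o :* (o :* ((U :- (D :+ D)) :+ V))) refl 1# U D V ⟩
    1# * (1# * ((U - (D + D)) + V))
      ≈⟨ trans (*-identityˡ _) (*-identityˡ _) ⟩
    (U - (D + D)) + V ∎))
    where
    U = norm² u
    V = norm² v
    D = dot u v

  Simplex : ∀ {n} → (Fin n → Carrier) → Set _
  Simplex w = (∀ i → 0# ≤ w i) × ∑ w ≈ 1#

  Minimal : ∀ {n m} → (Fin n → Fin m → Carrier) → (Fin n → Carrier) → Set _
  Minimal x u = ∀ w → Simplex w → norm² (comb u x) ≤ norm² (comb w x)

  -- A vanishing weight puts the point on a face. This property confines the search for a minimum to
  -- the faces, and in the colourful theorem it frees a colour.
  BoundaryRetract : ∀ {n m} → (Fin n → Fin m → Carrier) → Set _
  BoundaryRetract x = ∀ w → Simplex w →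
    ∃[ w′ ] Simplex w′ × (∃[ i ] w′ i ≈ 0#) × norm² (comb w′ x) ≤ norm² (comb w x)

  comb-scale : ∀ {n m} a (w : Fin n → Carrier) (x : Fin n → Fin m → Carrier) k →
               comb (λ i → a * w i) x k ≈ a * comb w x k
  comb-scale a w x k = trans (∑-cong (λ i → *-assoc a (w i) (x i k))) (∑-*ˡ a _)

  comb-ray : ∀ {n m} (w : Fin n → Carrier) t c (x : Fin n → Fin m → Carrier) k →
             comb (λ i → w i + t * c i) x k ≈ comb w x k + t * comb c x k
  comb-ray w t c x k = begin
    ∑ (λ i → (w i + t * c i) * x i k)
      ≈⟨ ∑-cong (λ i → solve 4 (λ w t c x → (w :+ t :* c) :* x := w :* x :+ t :* (c :* x))
          refl (w i) t (c i) (x i k)) ⟩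
    ∑ (λ i → w i * x i k + t * (c i * x i k))
      ≈⟨ trans (∑-+ _ _) (+-congˡ (∑-*ˡ t _)) ⟩
    comb w x k + t * comb c x k ∎

  -- If the coefficients c sum to zero, then comb c x is orthogonal to itself,
  -- so c is an affine dependence.  Otherwise c normalises to the point of the
  -- affine hull of x closest to the origin: either that point is a convex
  -- combination of x, or segments towards it leave the simplex through the
  -- boundary while the norm decreases.
  retract-or-minimum : ∀ {n m} (x : Fin n → Fin m → Carrier) c → Nontrivial c →
    ∀ β → (∀ j → dot (comb c x) (x j) ≈ β) →
    BoundaryRetract x ⊎ (∃[ μ ] Simplex (λ i → μ * c i) × Minimal x (λ i → μ * c i))
  retract-or-minimum {n} x c nt β level with ∑ c ≈? 0#
  ... | yes ∑c≈0 = inj₁ retract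
    where
    v = comb c x

    dot-self : norm² v ≈ 0#
    dot-self = begin
      dot v v                     ≈⟨ dot-comb c x v ⟩
      ∑ (λ i → c i * dot (x i) v) ≈⟨ ∑-cong (λ i → trans
          (*-congˡ (trans (∑-cong (λ k → *-comm _ _)) (level i))) (*-comm _ _)) ⟩
      ∑ (λ i → β * c i)           ≈⟨ ∑-*ˡ β c ⟩
      β * ∑ c                     ≈⟨ *-congˡ ∑c≈0 ⟩
      β * 0#                      ≈⟨ zeroʳ β ⟩
      0#                          ∎

    retract : BoundaryRetract x
    retract w (0≤w , ∑w≈1) with exit w c 0≤w (negative-coordinate nt ∑c≈0)
    ... | t , 0≤t , 0≤w′ , i , w′ᵢ≈0 = w′ , (0≤w′ , ∑w′≈1) , (i , w′ᵢ≈0) , inj₂ (dot-cong same same)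
      where
      w′ = λ i → w i + t * c i

      ∑w′≈1 : ∑ w′ ≈ 1#
      ∑w′≈1 = begin
        ∑ w′            ≈⟨ trans (∑-+ _ _) (+-congˡ (∑-*ˡ t c)) ⟩
        ∑ w + t * ∑ c   ≈⟨ +-cong ∑w≈1 (trans (*-congˡ ∑c≈0) (zeroʳ t)) ⟩
        1# + 0#         ≈⟨ +-identityʳ 1# ⟩
        1#              ∎

      same : ∀ k → comb w′ x k ≈ comb w x k
      same k = begin
        comb w′ x k           ≈⟨ comb-ray w t c x k ⟩
        comb w x k + t * v k  ≈⟨ +-congˡ (trans (*-congˡ (norm²-zero v dot-self k)) (zeroʳ t)) ⟩
        comb w x k + 0#       ≈⟨ +-identityʳ _ ⟩
        comb w x k            ∎
  ... | no ∑c≉0 with inverse (∑ c) ∑c≉0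
  ...   | μ , ∑c*μ≈1 = conclude
    where
    u = λ i → μ * c i
    q = comb u x
    γ = μ * β

    ∑u≈1 : ∑ u ≈ 1#
    ∑u≈1 = trans (∑-*ˡ μ c) (trans (*-comm _ _) ∑c*μ≈1)

    -- By `level`, `q` has inner product `γ` with every `x i`, hence with every affine combination
    -- of them, `q` itself included; so `norm² q ≈ γ`.
    dot-q : ∀ w → ∑ w ≈ 1# → dot (comb w x) q ≈ γ
    dot-q w ∑w≈1 = begin
      dot (comb w x) q            ≈⟨ dot-comb w x q ⟩
      ∑ (λ i → w i * dot (x i) q) ≈⟨ ∑-cong (λ i → trans (*-congˡ (leaf i)) (*-comm _ _)) ⟩
      ∑ (λ i → γ * w i)           ≈⟨ ∑-*ˡ γ w ⟩
      γ * ∑ w                     ≈⟨ *-congˡ ∑w≈1 ⟩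
      γ * 1#                      ≈⟨ *-identityʳ γ ⟩
      γ                           ∎
      where
      leaf : ∀ i → dot (x i) q ≈ γ
      leaf i = begin
        dot (x i) q                             ≈⟨ dot-cong (λ _ → refl) (comb-scale μ c x) ⟩
        dot (x i) (λ k → μ * comb c x k)        ≈⟨ ∑-cong (λ k → solve 3 (λ x m v → x :* (m :* v) := m :* (v :* x))
            refl (x i k) μ (comb c x k)) ⟩
        ∑ (λ k → μ * (comb c x k * x i k))      ≈⟨ ∑-*ˡ μ _ ⟩
        μ * dot (comb c x) (x i)                ≈⟨ *-congˡ (level i) ⟩
        γ                                       ∎

    -- By `dot-q`, this difference is the squared distance from `comb w x` to `q`.
    0≤Z-γ : ∀ w → ∑ w ≈ 1# → 0# ≤ norm² (comb w x) - γ
    0≤Z-γ w ∑w≈1 = ≤-trans (norm²-difference (comb w x) q) (inj₂ (begin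
      (Z - (dot (comb w x) q + dot (comb w x) q)) + norm² q
        ≈⟨ +-cong (+-congˡ (-‿cong (+-cong (dot-q w ∑w≈1) (dot-q w ∑w≈1)))) (dot-q u ∑u≈1) ⟩
      (Z - (γ + γ)) + γ
        ≈⟨ solve 2 (λ Z g → (Z :- (g :+ g)) :+ g := Z :- g) refl Z γ ⟩
      Z - γ ∎))
      where Z = norm² (comb w x)

    retract : (∃[ i ] u i < 0#) → BoundaryRetract x
    retract (i₀ , u₀<0) w (0≤w , ∑w≈1)
      with exit w (λ i → u i - w i) 0≤w (i₀ , 0<y-x⇒x<y (<-respʳ-≈
             (solve 3 (λ z u w → (z :- u) :+ w := z :- (u :- w)) refl 0# (u i₀) (w i₀))
             (+-pos-nonneg (x<y⇒0<y-x u₀<0) (0≤w i₀))))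
    ... | t , 0≤t , 0≤w′ , i , w′ᵢ≈0 = w′ , (0≤w′ , ∑w′≈1) , (i , w′ᵢ≈0) , 0≤y-x⇒x≤y gap
      where
      w′ = λ i → w i + t * (u i - w i)
      s = 1# - t
      Z = norm² (comb w x)

      s+t≈1 : s + t ≈ 1#
      s+t≈1 = solve 2 (λ o t → (o :- t) :+ t := o) refl 1# t

      -- The segment from `w` to `u` leaves the simplex before its end: at a parameter beyond `1#`
      -- the entry at `i₀`, where `u` is negative, would be negative.
      0≤s : 0# ≤ s
      0≤s with 1# <? t
      ... | no 1≮t = x≤y⇒0≤y-x (≮⇒≥ 1≮t)
      ... | yes 1<t = ⊥-elim (≤⇒≯ (0≤w′ i₀) (0<y-x⇒x<y (<-respʳ-≈ eq
              (+-pos-nonneg (*-pos (<-trans 0<1 1<t) (x<0⇒0<-x u₀<0))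
                            (*-nonneg (inj₁ (x<y⇒0<y-x 1<t)) (0≤w i₀))))))
        where
        eq : t * - u i₀ + (t - 1#) * w i₀ ≈ 0# - w′ i₀
        eq = begin
          t * - u i₀ + (t - 1#) * w i₀
            ≈⟨ solve 4 (λ t u w o → t :* (:- u) :+ (t :- o) :* w := :- (o :* w :+ t :* (u :- w)))
                refl t (u i₀) (w i₀) 1# ⟩
          - (1# * w i₀ + t * (u i₀ - w i₀))
            ≈⟨ -‿cong (+-congʳ (*-identityˡ (w i₀))) ⟩
          - w′ i₀
            ≈⟨ +-identityˡ _ ⟨
          0# - w′ i₀ ∎

      split : ∀ i → w′ i ≈ s * w i + t * u i
      split i = begin
        w i + t * (u i - w i)       ≈⟨ +-congʳ (*-identityˡ (w i)) ⟨
        1# * w i + t * (u i - w i)  ≈⟨ solve 4 (λ t u w o → o :* w :+ t :* (u :- w) := (o :- t) :* w :+ t :* u)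
            refl t (u i) (w i) 1# ⟩
        s * w i + t * u i           ∎

      ∑w′≈1 : ∑ w′ ≈ 1#
      ∑w′≈1 = begin
        ∑ w′                   ≈⟨ trans (∑-cong split) (∑-linear s t w u) ⟩
        s * ∑ w + t * ∑ u      ≈⟨ +-cong (*-congˡ ∑w≈1) (*-congˡ ∑u≈1) ⟩
        s * 1# + t * 1#        ≈⟨ +-cong (*-identityʳ s) (*-identityʳ t) ⟩
        s + t                  ≈⟨ s+t≈1 ⟩
        1#                     ∎

      norm²-w′ : norm² (comb w′ x) ≈ (s * s * Z + (s * t * γ + s * t * γ)) + t * t * γ
      norm²-w′ = begin
        norm² (comb w′ x)
          ≈⟨ dot-cong step step ⟩
        norm² (λ k → s * comb w x k + t * q k)
          ≈⟨ norm²-linear s t (comb w x) q ⟩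
        (s * s * Z + (s * t * dot (comb w x) q + s * t * dot (comb w x) q)) + t * t * norm² q
          ≈⟨ +-cong (+-congˡ (+-cong (*-congˡ (dot-q w ∑w≈1)) (*-congˡ (dot-q w ∑w≈1)))) (*-congˡ (dot-q u ∑u≈1)) ⟩
        (s * s * Z + (s * t * γ + s * t * γ)) + t * t * γ ∎
        where
        step : ∀ k → comb w′ x k ≈ s * comb w x k + t * q k
        step k = trans (∑-cong (λ i → *-congʳ (split i))) (comb-linear s t w u x k)

      -- Since `s + t ≈ 1#`, the new squared norm is `s * s * Z + (1# - s * s) * γ`, a drop of
      -- `(1# - s * s) * (Z - γ)`. The first factor is written as a sum of nonnegative products.
      gap : 0# ≤ Z - norm² (comb w′ x)
      gap = ≤-trans (*-nonneg (+-nonneg (*-nonneg 0≤s 0≤t) (+-nonneg (*-nonneg 0≤s 0≤t) (*-nonneg 0≤t 0≤t)))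
          (0≤Z-γ w ∑w≈1))
        (inj₂ (begin
          (s * t + (s * t + t * t)) * (Z - γ)
            ≈⟨ solve 4 (λ s t Z g → (s :* t :+ (s :* t :+ t :* t)) :* (Z :- g) :=
                 (s :+ t) :* ((s :+ t) :* Z) :- ((s :* s :* Z :+ (s :* t :* g :+ s :* t :* g)) :+ t :* t :* g))
                     refl s t Z γ ⟩
          (s + t) * ((s + t) * Z) - ((s * s * Z + (s * t * γ + s * t * γ)) + t * t * γ)
            ≈⟨ +-cong (trans (one _) (one Z)) (-‿cong (sym norm²-w′)) ⟩
          Z - norm² (comb w′ x) ∎))
        where
        one : ∀ y → (s + t) * y ≈ y
        one y = trans (*-congʳ s+t≈1) (*-identityˡ y)

    conclude : BoundaryRetract x ⊎ (∃[ μ ] Simplex (λ i → μ * c i) × Minimal x (λ i → μ * c i))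
    conclude with any? (λ i → u i <? 0#)
    ... | yes neg = inj₁ (retract neg)
    ... | no none = inj₂ (μ , ((λ i → ≮⇒≥ (λ uᵢ<0 → none (i , uᵢ<0))) , ∑u≈1) ,
            λ w (_ , ∑w≈1) → 0≤y-x⇒x≤y (≤-trans (0≤Z-γ w ∑w≈1) (inj₂ (+-congˡ (-‿cong (sym (dot-q u ∑u≈1)))))))

  argmin : ∀ {n} (g : Fin n → Carrier) → Fin n → ∃[ i ] ∀ j → g i ≤ g j
  argmin {suc zero} g _ = zero , λ { zero → ≤-refl }
  argmin {suc (suc n)} g _ with argmin (g ∘ suc) zero
  ... | i , min with ≤-total (g zero) (g (suc i))
  ...   | inj₁ le = zero , λ { zero → ≤-refl ; (suc j) → ≤-trans le (min j) }
  ...   | inj₂ ge = suc i , λ { zero → ge ; (suc j) → min j }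

  ∑-restrict : ∀ {n} i (f : Fin (suc n) → Carrier) → f i ≈ 0# → ∑ (f ∘ punchIn i) ≈ ∑ f
  ∑-restrict i f fᵢ≈0 = sym (trans (∑-remove i f) (trans (+-congʳ fᵢ≈0) (+-identityˡ _)))

  comb-restrict : ∀ {n m} i (w : Fin (suc n) → Carrier) (x : Fin (suc n) → Fin m → Carrier) → w i ≈ 0# →
                  ∀ k → comb (w ∘ punchIn i) (x ∘ punchIn i) k ≈ comb w x k
  comb-restrict i w x wᵢ≈0 k = ∑-restrict i _ (trans (*-congʳ wᵢ≈0) (zeroˡ _))

  extend-nonneg : ∀ {n} (i : Fin (suc n)) {w : Fin n → Carrier} →
      (∀ j → 0# ≤ w j) → ∀ j → 0# ≤ insertAt w i 0# j
  extend-nonneg i {w} 0≤w j with i ≟ j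
  ... | yes ≡.refl = inj₂ (reflexive (≡.sym (insertAt-lookup w i 0#)))
  ... | no i≢j = ≡.subst (λ j → 0# ≤ insertAt w i 0# j) (punchIn-punchOut i≢j)
          (≤-trans (0≤w _) (inj₂ (reflexive (≡.sym (insertAt-punchIn w i 0# _)))))

  ∑-extend : ∀ {n} i (w : Fin n → Carrier) → ∑ (insertAt w i 0#) ≈ ∑ w
  ∑-extend i w = trans (sym (∑-restrict i _ (reflexive (insertAt-lookup w i 0#))))
                       (∑-cong (λ j → reflexive (insertAt-punchIn w i 0# j)))

  comb-extend : ∀ {n m} i (w : Fin n → Carrier) (x : Fin (suc n) → Fin m → Carrier) k →
                comb (insertAt w i 0#) x k ≈ comb w (x ∘ punchIn i) k
  comb-extend i w x k = trans (∑-insertAt i 0# w (λ j → x j k)) (trans (+-congʳ (zeroˡ _)) (+-identityˡ _))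

  -- The normal equations of the closest point of the affine hull, made
  -- homogeneous, always have a nontrivial solution.
  closest-point : ∀ {n m} (x : Fin (suc n) → Fin m → Carrier) → ∃[ w ] Simplex w × Minimal x w
  closest-point {zero} x = const 1# , ((λ _ → inj₁ 0<1) , single (const 1#)) ,
    λ w (_ , ∑w≈1) → inj₂ (dot-cong (same w ∑w≈1) (same w ∑w≈1))
    where
    single : (f : Fin 1 → Carrier) → ∑ f ≈ f zero
    single f = trans (∑-remove zero f) (trans (+-congˡ (∑-zero (λ ()))) (+-identityʳ _))

    same : ∀ w → ∑ w ≈ 1# → ∀ k → comb (const 1#) x k ≈ comb w x k
    same w ∑w≈1 k = ∑-cong λ { zero → *-congʳ (trans (sym ∑w≈1) (single w)) }
  closest-point {suc n} x with kernel (ℕ.n<1+n (suc n)) (λ i j → dot (x i) (x (suc j)) - dot (x i) (x zero))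
  ... | c , nt , eqs = [ from-faces , (λ (μ , Δ , min) → _ , Δ , min) ]′ (retract-or-minimum x c nt _ level)
    where
    level : ∀ j → dot (comb c x) (x j) ≈ dot (comb c x) (x zero)
    level zero = refl
    level (suc j) = x-y≈0⇒x≈y (begin
      dot (comb c x) (x (suc j)) - dot (comb c x) (x zero)
        ≈⟨ +-cong (dot-comb c x _) (-‿cong (dot-comb c x _)) ⟩
      ∑ (λ i → c i * A i) - ∑ (λ i → c i * B i)
        ≈⟨ solve 3 (λ o a b → a :- b := a :+ (:- b)) refl 1# _ _ ⟩
      ∑ (λ i → c i * A i) + - ∑ (λ i → c i * B i)
        ≈⟨ +-cong (*-identityˡ _) (trans (sym (-‿distribˡ-* 1# _)) (-‿cong (*-identityˡ _))) ⟨
      1# * ∑ (λ i → c i * A i) + - 1# * ∑ (λ i → c i * B i)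
        ≈⟨ ∑-linear 1# (- 1#) _ _ ⟨
      ∑ (λ i → 1# * (c i * A i) + - 1# * (c i * B i))
        ≈⟨ ∑-cong (λ i → trans (solve 4 (λ o c a b → o :* (c :* a) :+ (:- o) :* (c :* b) := o :* (c :* (a :- b)))
            refl 1# (c i) (A i) (B i)) (*-identityˡ _)) ⟩
      ∑ (λ i → c i * (A i - B i))
        ≈⟨ eqs j ⟩
      0# ∎)
      where
      A = λ i → dot (x i) (x (suc j))
      B = λ i → dot (x i) (x zero)

    -- A retracted point has some weight `j` equal to zero, so it is no closer to the origin than
    -- the minimiser on face `j`, which the recursion provides. The best of these minimisers is the
    -- answer.
    from-faces : BoundaryRetract x → ∃[ w ] Simplex w × Minimal x w
    from-faces retract = w i , Δ i , λ w′ Δ′ → let w″ , Δ″ , (j , zⱼ) , le = retract w′ Δ′ in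
        ≤-trans (best j) (≤-trans (faces j w″ Δ″ zⱼ) le)
      where
      face = λ i → closest-point (x ∘ punchIn i)
      w = λ i → insertAt (proj₁ (face i)) i 0#

      Δ : ∀ i → Simplex (w i)
      Δ i = let v , (0≤v , ∑v≈1) , _ = face i in extend-nonneg i 0≤v , trans (∑-extend i v) ∑v≈1

      faces : ∀ i w″ → Simplex w″ → w″ i ≈ 0# → norm² (comb (w i) x) ≤ norm² (comb w″ x)
      faces i w″ (0≤w″ , ∑w″≈1) zᵢ = let v , _ , min = face i in
        ≤-trans (inj₂ (dot-cong (comb-extend i v x) (comb-extend i v x)))
        (≤-trans (min (w″ ∘ punchIn i) ((0≤w″ ∘ punchIn i) , trans (∑-restrict i w″ zᵢ) ∑w″≈1))
        (inj₂ (dot-cong (comb-restrict i w″ x zᵢ) (comb-restrict i w″ x zᵢ))))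

      smallest = argmin (λ i → norm² (comb (w i) x)) zero
      i = proj₁ smallest
      best = proj₂ smallest

-- Carathéodory's theorem and its colourful version.

module Carathéodory {c ℓ₁ ℓ₂} (ℝ : CompleteOrderedField c ℓ₁ ℓ₂) where

  open OrderedFieldProperties ℝ
  open LinearCombinations ℝ
  open ConvexCombinations ℝ
  open SetoidReasoning setoid

  δ : ∀ {n} → Fin n → Fin n → Carrier
  δ i j = if does (i ≟ j) then 1# else 0#

  δ-≡ : ∀ {n} (i : Fin n) → δ i i ≈ 1#
  δ-≡ i with i ≟ i
  ... | yes _ = refl
  ... | no i≢i = ⊥-elim (i≢i ≡.refl)

  δ-≢ : ∀ {n} {i j : Fin n} → i ≢ j → δ i j ≈ 0#
  δ-≢ {i = i} {j} i≢j with i ≟ j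
  ... | yes i≡j = ⊥-elim (i≢j i≡j)
  ... | no _ = refl

  δ-nonneg : ∀ {n} (i j : Fin n) → 0# ≤ δ i j
  δ-nonneg i j with i ≟ j
  ... | yes _ = inj₁ 0<1
  ... | no _ = ≤-refl

  ∑-δ : ∀ {n} (i : Fin n) (f : Fin n → Carrier) → ∑ (λ j → δ i j * f j) ≈ f i
  ∑-δ {suc n} i f = begin
    ∑ (λ j → δ i j * f j)
      ≈⟨ ∑-remove i _ ⟩
    δ i i * f i + ∑ (λ j → δ i (punchIn i j) * f (punchIn i j))
      ≈⟨ +-cong (trans (*-congʳ (δ-≡ i)) (*-identityˡ _))
                (∑-zero (λ j → trans (*-congʳ (δ-≢ (punchInᵢ≢i i j ∘ ≡.sym))) (zeroˡ _))) ⟩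
    f i + 0#
      ≈⟨ +-identityʳ _ ⟩
    f i ∎

  ∑δ≈1 : ∀ {n} (i : Fin n) → ∑ (δ i) ≈ 1#
  ∑δ≈1 i = trans (∑-cong (λ j → sym (*-identityʳ (δ i j)))) (∑-δ i (const 1#))

  -- More than `suc m` points have an affine dependence. Moving `w` along it until a weight vanishes
  -- changes neither the sum nor the combination, and the point without weight is dropped. The
  -- weights are not normalised, so their sum is among the preserved quantities.
  carathéodory : ∀ {n m} (x : Fin n → Fin m → Carrier) w → (∀ i → 0# ≤ w i) →
    ∃[ w′ ] (∀ i → 0# ≤ w′ i) × ∑ w′ ≈ ∑ w × (∀ k → comb w′ x k ≈ comb w x k) ×
    ∃[ A ] length A ℕ.≤ suc m × (∀ i → i ∉ A → w′ i ≈ 0#)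
  carathéodory {n} {m} x w 0≤w with n ℕ.≤? suc m
  carathéodory {n} {m} x w 0≤w | yes n≤1+m = w , 0≤w , refl , (λ _ → refl) , allFin n ,
    ≡.subst (ℕ._≤ suc m) (≡.sym (length-tabulate {n = n} id)) n≤1+m , λ i i∉ → ⊥-elim (i∉ (∈-allFin i))
  carathéodory {zero} x w 0≤w | no n≰1+m = ⊥-elim (n≰1+m z≤n)
  carathéodory {suc n} {m} x w 0≤w | no n≰1+m
    -- The constant coordinate `1#` makes the linear dependence an affine one.
    with kernel {suc m} (ℕ.≰⇒> n≰1+m) (λ i → λ { zero → 1# ; (suc k) → x i k })
  ... | c , nt , eqs
    with exit w c 0≤w (negative-coordinate nt (trans (∑-cong (λ i → sym (*-identityʳ (c i)))) (eqs zero)))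
  ... | t , 0≤t , 0≤v , i , vᵢ≈0
    with carathéodory (x ∘ punchIn i) (λ j → w (punchIn i j) + t * c (punchIn i j)) (0≤v ∘ punchIn i)
  ... | u , 0≤u , ∑u , comb-u , A , ∣A∣ , off-A = insertAt u i 0# , extend-nonneg i 0≤u , ∑-eq , comb-eq ,
      map (punchIn i) A , ≡.subst (ℕ._≤ suc m) (≡.sym (length-map (punchIn i) A)) ∣A∣ , off
    where
    v = λ j → w j + t * c j

    ∑-eq : ∑ (insertAt u i 0#) ≈ ∑ w
    ∑-eq = begin
      ∑ (insertAt u i 0#)              ≈⟨ ∑-extend i u ⟩
      ∑ u                              ≈⟨ ∑u ⟩
      ∑ (v ∘ punchIn i)                ≈⟨ ∑-restrict i v vᵢ≈0 ⟩
      ∑ v                              ≈⟨ trans (∑-+ _ _) (+-congˡ (∑-*ˡ t c)) ⟩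
      ∑ w + t * ∑ c                    ≈⟨ +-congˡ (*-congˡ (trans (∑-cong (λ i → sym (*-identityʳ (c i)))) (eqs zero))) ⟩
      ∑ w + t * 0#                     ≈⟨ trans (+-congˡ (zeroʳ t)) (+-identityʳ _) ⟩
      ∑ w                              ∎

    comb-eq : ∀ k → comb (insertAt u i 0#) x k ≈ comb w x k
    comb-eq k = begin
      comb (insertAt u i 0#) x k               ≈⟨ comb-extend i u x k ⟩
      comb u (x ∘ punchIn i) k                 ≈⟨ comb-u k ⟩
      comb (v ∘ punchIn i) (x ∘ punchIn i) k   ≈⟨ comb-restrict i v x vᵢ≈0 k ⟩
      comb v x k                               ≈⟨ comb-ray w t c x k ⟩
      comb w x k + t * comb c x k              ≈⟨ +-congˡ (*-congˡ (eqs (suc k))) ⟩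
      comb w x k + t * 0#                      ≈⟨ trans (+-congˡ (zeroʳ t)) (+-identityʳ _) ⟩
      comb w x k                               ∎

    off : ∀ j → j ∉ map (punchIn i) A → insertAt u i 0# j ≈ 0#
    off j j∉ with i ≟ j
    ... | yes ≡.refl = reflexive (insertAt-lookup u i 0#)
    ... | no i≢j = ≡.subst (λ j → insertAt u i 0# j ≈ 0#) (punchIn-punchOut i≢j)
            (trans (reflexive (insertAt-punchIn u i 0# _))
              (off-A _ (λ ∈A → j∉
                  (≡.subst (_∈ map (punchIn i) A) (punchIn-punchOut i≢j) (∈-map⁺ (punchIn i) ∈A)))))

  private
    nonpositive-term : ∀ {r} (f : Fin (suc r) → Carrier) → ∑ f ≈ 0# → ∃[ l ] f l ≤ 0#
    nonpositive-term f ∑f≈0 with any? (λ l → ¬? (0# <? f l))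
    ... | yes (l , f≯0) = l , ≮⇒≥ f≯0
    ... | no none = ⊥-elim (0<⇒≉0 (pos zero) (∑-nonneg-zero (λ l → inj₁ (pos l)) (inj₂ ∑f≈0) zero))
      where
      pos : ∀ l → 0# < f l
      pos l with 0# <? f l
      ... | yes 0<f = 0<f
      ... | no f≯0 = ⊥-elim (none (l , f≯0))

  -- Bárány's argument: if the colourful hull closest to the origin misses it,
  -- then its closest point p can be written without using some colour i, and
  -- the point of colour i can be replaced by one on the other side of the
  -- hyperplane through the origin orthogonal to p, which decreases the distance.
  colourful-carathéodory : ∀ {n r m} → m ℕ.< n → (X : Fin n → Fin (suc r) → Fin m → Carrier) →
    (∀ i k → ∑ (λ l → X i l k) ≈ 0#) →
    ∃ λ (f : Fin n → Fin (suc r)) → ∃[ w ] Simplex w × (∀ k → comb w (λ i → X i (f i)) k ≈ 0#)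
  colourful-carathéodory {suc n} {r} {m} m<n X balanced = conclude
    where
    pick : (Fin (suc n) → Fin (suc r)) → Fin (suc n) → Fin m → Carrier
    pick f i = X i (f i)

    hull : ∀ f → ∃[ w ] Simplex w × Minimal (pick f) w
    hull f = closest-point (pick f)

    distance : (Fin (suc n) → Fin (suc r)) → Carrier
    distance f = norm² (comb (proj₁ (hull f)) (pick f))

    -- `funToFin` encodes the choices of one vector per colour in a finite type, over which `argmin`
    -- ranges; the constant choice shows that there is one.
    closest = argmin (distance ∘ finToFun {suc r} {suc n}) (funToFin {suc n} (λ _ → zero))
    f = finToFun {suc r} {suc n} (proj₁ closest)
    w = proj₁ (hull f)
    Δw = proj₁ (proj₂ (hull f))

    distance≤ : ∀ g v → Simplex v → distance f ≤ norm² (comb v (pick g))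
    distance≤ g v Δv = ≤-trans (proj₂ closest (funToFin g))
      (≤-trans (proj₂ (proj₂ (hull _)) v Δv) (inj₂ (dot-cong same same)))
      where
      same : ∀ k → comb v (pick (finToFun (funToFin g))) k ≈ comb v (pick g) k
      same k = ∑-cong (λ i → *-congˡ (reflexive (≡.cong (λ l → X i l k) (finToFun-funToFin g i))))

    Goal : Set _
    Goal = ∃[ f ] ∃[ w ] Simplex w × (∀ k → comb w (pick f) k ≈ 0#)

    swap-colour : BoundaryRetract (pick f) → Goal
    swap-colour retract with retract w Δw
    ... | w′ , Δw′ , (i , w′ᵢ≈0) , le with norm² (comb w′ (pick f)) ≈? 0#
    ...   | yes P≈0 = f , w′ , Δw′ , norm²-zero _ P≈0
    ...   | no P≉0 with nonpositive-term (λ l → dot (X i l) (comb w′ (pick f))) sum-dots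
      where
      sum-dots : ∑ (λ l → dot (X i l) (comb w′ (pick f))) ≈ 0#
      sum-dots = trans (∑-swap _) (∑-zero (λ k →
        trans (∑-cong (λ l → *-comm _ _)) (trans (∑-*ˡ _ _) (trans (*-congˡ (balanced i k)) (zeroʳ _)))))
    ...     | l , Xᵢₗ·p≤0 = ⊥-elim contradiction
      where
      p = comb w′ (pick f)
      y = X i l
      P = norm² p
      Y = norm² y
      D = dot p y

      D≤0 : D ≤ 0#
      D≤0 = ≤-trans (inj₂ (∑-cong (λ k → *-comm _ _))) Xᵢₗ·p≤0

      0<P : 0# < P
      0<P with norm²-nonneg p
      ... | inj₁ 0<P = 0<P
      ... | inj₂ 0≈P = ⊥-elim (P≉0 (sym 0≈P))

      scale = positive-inverse (+-pos-nonneg 0<P (norm²-nonneg y))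
      λ′ = proj₁ scale
      0<λ′ = proj₁ (proj₂ scale)

      -- The weights are proportional to `Y` and `P`. As `D ≤ 0#`, the point with weights `a` on `p`
      -- and `b` on `y` has squared norm at most `a * a * P + b * b * Y`, which equals `a * P`, that
      -- is, `P - b * P`.
      a = λ′ * Y
      b = λ′ * P

      0≤a : 0# ≤ a
      0≤a = *-nonneg (inj₁ 0<λ′) (norm²-nonneg y)

      0<b : 0# < b
      0<b = *-pos 0<λ′ 0<P

      a+b≈1 : a + b ≈ 1#
      a+b≈1 = trans (solve 3 (λ s P Y → s :* Y :+ s :* P := (P :+ Y) :* s)
          refl λ′ P Y) (proj₂ (proj₂ scale))

      g = updateAt f i (const l)
      v = λ j → a * w′ j + b * δ i j

      Δv : Simplex v
      Δv = (λ j → +-nonneg (*-nonneg 0≤a (proj₁ Δw′ j)) (*-nonneg (inj₁ 0<b) (δ-nonneg i j))) , (begin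
        ∑ v                    ≈⟨ ∑-linear a b w′ (δ i) ⟩
        a * ∑ w′ + b * ∑ (δ i) ≈⟨ +-cong (*-congˡ (proj₂ Δw′)) (*-congˡ (∑δ≈1 i)) ⟩
        a * 1# + b * 1#        ≈⟨ +-cong (*-identityʳ a) (*-identityʳ b) ⟩
        a + b                  ≈⟨ a+b≈1 ⟩
        1#                     ∎)

      comb-v : ∀ k → comb v (pick g) k ≈ a * p k + b * y k
      comb-v k = begin
        comb v (pick g) k
          ≈⟨ comb-linear a b w′ (δ i) (pick g) k ⟩
        a * comb w′ (pick g) k + b * comb (δ i) (pick g) k
          ≈⟨ +-cong (*-congˡ (∑-cong old)) (*-congˡ (trans (∑-δ i _) new)) ⟩
        a * p k + b * y k ∎
        where
        new : pick g i k ≈ y k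
        new = reflexive (≡.cong (λ l → X i l k) (updateAt-updates i f))

        old : ∀ j → w′ j * pick g j k ≈ w′ j * pick f j k
        old j with j ≟ i
        ... | yes ≡.refl = trans (trans (*-congʳ w′ᵢ≈0) (zeroˡ _)) (sym (trans (*-congʳ w′ᵢ≈0) (zeroˡ _)))
        ... | no j≢i = *-congˡ (reflexive (≡.cong (λ l → X j l k) (updateAt-minimal j i f j≢i)))

      N = norm² (comb v (pick g))

      N-eq : N ≈ (a * a * P + (a * b * D + a * b * D)) + b * b * Y
      N-eq = trans (dot-cong comb-v comb-v) (norm²-linear a b p y)

      P≤N : P ≤ N
      P≤N = ≤-trans le (distance≤ g v Δv)

      0≤-D : 0# ≤ - D
      0≤-D = ≤-trans (x≤y⇒0≤y-x D≤0) (inj₂ (+-identityˡ _))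

      0≤ab : 0# ≤ (a * b) * - D
      0≤ab = *-nonneg (*-nonneg 0≤a (inj₁ 0<b)) 0≤-D

      loss : (N - P) + ((a * b) * - D + (a * b) * - D) ≈ - (b * P)
      loss = begin
        (N - P) + ((a * b) * - D + (a * b) * - D)
          ≈⟨ +-congʳ (+-congʳ N-eq) ⟩
        (((a * a * P + (a * b * D + a * b * D)) + b * b * Y) - P) + ((a * b) * - D + (a * b) * - D)
          ≈⟨ solve 4 (λ s P Y D → let a = s :* Y ; b = s :* P in
               (((a :* a :* P :+ (a :* b :* D :+ a :* b :* D)) :+ b :* b :* Y) :- P)
                 :+ ((a :* b) :* (:- D) :+ (a :* b) :* (:- D))
               := (a :+ b) :* (a :* P) :- P) refl λ′ P Y D ⟩
        (a + b) * (a * P) - P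
          ≈⟨ +-cong (trans (*-congʳ a+b≈1) (*-identityˡ _))
              (-‿cong (trans (sym (*-identityˡ P)) (*-congʳ (sym a+b≈1)))) ⟩
        a * P - (a + b) * P
          ≈⟨ solve 3 (λ a b P → a :* P :- (a :+ b) :* P := :- (b :* P)) refl a b P ⟩
        - (b * P) ∎

      contradiction = <-irrefl refl (<-≤-trans (*-pos 0<b 0<P) (0≤y-x⇒x≤y (≤-trans
        (+-nonneg (x≤y⇒0≤y-x P≤N) (+-nonneg 0≤ab 0≤ab)) (inj₂ (trans loss (sym (+-identityˡ _)))))))

    conclude : Goal
    -- There are more colours than coordinates, so the chosen vectors are linearly dependent. Their
    -- combination by `c` is the origin, so the level is zero, and in the second case the scaled `c`
    -- is a convex combination giving the origin.
    conclude with kernel m<n (pick f)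
    ... | c , nt , eqs with retract-or-minimum (pick f) c nt 0#
          (λ j → ∑-zero (λ k → trans (*-congʳ (eqs k)) (zeroˡ _)))
    ...   | inj₁ retract = swap-colour retract
    ...   | inj₂ (μ , Δ , _) = f , (λ i → μ * c i) , Δ ,
            λ k → trans (comb-scale μ c (pick f) k) (trans (*-congˡ (eqs k)) (zeroʳ μ))

-- Labellings and the partitions into their fibres.

Labelling : ℕ → ℕ → Set
Labelling n r = Fin n → Fin r

module Labellings {n r : ℕ} where

  open DecMembership (_≟_ {n}) using (_∈?_)

  Onto : Labelling n r → Set
  Onto f = ∀ j → ∃[ i ] f i ≡ j

  fibre : Labelling n r → Fin r → Subset n
  fibre f j = tabulate (λ i → does (f i ≟ j))

  ∈-fibre⁺ : ∀ {f : Labelling n r} {i j} → f i ≡ j → i ∈ˢ fibre f j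
  ∈-fibre⁺ {f} {i} {j} e = lookup⇒[]= i _ (≡.trans (lookup∘tabulate _ i)
    (dec-true (f i ≟ j) e))

  ∈-fibre⁻ : ∀ {f : Labelling n r} {i j} → i ∈ˢ fibre f j → f i ≡ j
  ∈-fibre⁻ {f} {i} {j} i∈ with f i ≟ j
      | ≡.trans (≡.sym (lookup∘tabulate (λ i → does (f i ≟ j)) i)) ([]=⇒lookup i∈)
  ... | yes e | _ = e

  fibres : (f : Labelling n r) → Onto f → Partition n r
  fibres f onto = record
    { part     = fibre f
    ; nonempty = λ j → let i , e = onto j in i , ∈-fibre⁺ {f} e
    ; disjoint = λ i j i≢j (x , x∈) → let x∈i , x∈j = x∈p∩q⁻ _ _ x∈ in
        i≢j (≡.trans (≡.sym (∈-fibre⁻ {f} x∈i)) (∈-fibre⁻ {f} x∈j))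
    ; covers   = λ x → f x , ∈-fibre⁺ {f} ≡.refl
    }

  label : Partition n r → Labelling n r
  label P x = proj₁ (covers P x)

  label⁻ : ∀ (P : Partition n r) {x j} → label P x ≡ j → x ∈ˢ part P j
  label⁻ P {x} ≡.refl = proj₂ (covers P x)

  label⁺ : ∀ (P : Partition n r) {x j} → x ∈ˢ part P j → label P x ≡ j
  label⁺ P {x} {j} x∈j with label P x ≟ j
  ... | yes e = e
  ... | no ne = ⊥-elim (disjoint P _ _ ne (x , x∈p∩q⁺ (proj₂ (covers P x) , x∈j)))

  fibres-label : ∀ (P : Partition n r) (onto : Onto (label P)) → P ≈ᴾ fibres (label P) onto
  fibres-label P onto = (λ j → j , same j) , λ j → j , ≡.sym (same j)
    where
    same : ∀ j → part P j ≡ fibre (label P) j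
    same j = ⊆-antisym (λ x∈ → ∈-fibre⁺ {label P} (label⁺ P x∈)) (λ x∈ → label⁻ P (∈-fibre⁻ {label P} x∈))

  fibres-cong : ∀ {f g : Labelling n r} (of : Onto f) (og : Onto g) → f ≗ g → fibres f of ≈ᴾ fibres g og
  fibres-cong {f} {g} _ _ f≗g = (λ j → j , same j) , λ j → j , ≡.sym (same j)
    where
    same : ∀ j → fibre f j ≡ fibre g j
    same j = ⊆-antisym (λ {x} x∈ → ∈-fibre⁺ {g} (≡.trans (≡.sym (f≗g x)) (∈-fibre⁻ {f} x∈)))
                       (λ {x} x∈ → ∈-fibre⁺ {f} (≡.trans (f≗g x) (∈-fibre⁻ {g} x∈)))

  private
    x∈p─q⇒x∉q : ∀ {m} {x : Fin m} (p q : Subset m) → x ∈ˢ p ─ q → x ∉ˢ q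
    x∈p─q⇒x∉q (_ ∷ p) (true ∷ q)  (there x∈) (there x∈q) = x∈p─q⇒x∉q p q x∈ x∈q
    x∈p─q⇒x∉q (_ ∷ p) (false ∷ q) (there x∈) (there x∈q) = x∈p─q⇒x∉q p q x∈ x∈q

    restrict : ∀ {f g : Labelling n r} x → (∀ i → i ≢ x → f i ≡ g i) →
               ∀ j {y} → y ∈ˢ fibre f j ─ ⁅ x ⁆ → y ∈ˢ fibre g j ─ ⁅ x ⁆
    restrict {f} {g} x f≡g j {y} y∈ = x∈p∧x∉q⇒x∈p─q
      (∈-fibre⁺ {g} (≡.trans (≡.sym (f≡g y y≢x)) (∈-fibre⁻ {f} (p─q⊆p _ _ y∈)))) (x≢y⇒x∉⁅y⁆ y≢x)
      where
      y≢x : y ≢ x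
      y≢x ≡.refl = x∈p─q⇒x∉q (fibre f j) ⁅ x ⁆ y∈ (x∈⁅x⁆ x)

  -- Removing `x` makes the partitions agree. For the lower bound, surjectivity of `g` gives a point
  -- `y` with `g y ≡ f x`; it differs from `x`, so `f y ≡ f x` as well. Thus `x` and `y` share a
  -- part of the first partition but not of the second, and something must be removed.
  distance-relabel : ∀ {f g : Labelling n r} (of : Onto f) (og : Onto g) x →
      (∀ i → i ≢ x → f i ≡ g i) → f x ≢ g x →
                     Distance (fibres f of) (fibres g og) 1
  distance-relabel {f} {g} of og x f≡g fx≢gx =
    (⁅ x ⁆ , ∣⁅x⁆∣≡1 x , (λ j _ → j , same j) , (λ j _ → j , ≡.sym (same j))) , lower
    where
    same : ∀ j → fibre f j ─ ⁅ x ⁆ ≡ fibre g j ─ ⁅ x ⁆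
    same j = ⊆-antisym (restrict {f} {g} x f≡g j) (restrict {g} {f} x (λ i i≢x → ≡.sym (f≡g i i≢x)) j)

    lower : ∀ X → RestrictionsCoincide X (fibres f of) (fibres g og) → 1 ℕ.≤ ∣ X ∣
    lower X (P⊑Q , _) with nonempty? X
    ... | yes (z , z∈X) = ≡.subst (ℕ._≤ ∣ X ∣) (∣⁅x⁆∣≡1 z)
            (p⊆q⇒∣p∣≤∣q∣ (λ y∈ → ≡.subst (_∈ˢ X) (≡.sym (x∈⁅y⁆⇒x≡y z y∈)) z∈X))
    ... | no empty = ⊥-elim (fx≢gx
        (≡.sym (≡.trans (∈-fibre⁻ {g} (inside x ≡.refl)) (≡.trans (≡.sym (∈-fibre⁻ {g} (inside y fy≡fx))) gy≡fx))))
      where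
      y = proj₁ (og (f x))
      gy≡fx = proj₂ (og (f x))

      fy≡fx : f y ≡ f x
      fy≡fx with y ≟ x
      ... | yes y≡x = ≡.cong f y≡x
      ... | no y≢x = ≡.trans (f≡g y y≢x) gy≡fx

      stays : ∀ i → f i ≡ f x → i ∈ˢ fibre f (f x) ─ X
      stays i e = x∈p∧x∉q⇒x∈p─q (∈-fibre⁺ {f} e) (λ i∈X → empty (i , i∈X))

      matched = P⊑Q (f x) (x , stays x ≡.refl)

      inside : ∀ i → f i ≡ f x → i ∈ˢ fibre g (proj₁ matched)
      inside i e = p─q⊆p _ X (≡.subst (i ∈ˢ_) (proj₂ matched) (stays i e))

  override : List (Fin n) → Labelling n r → Labelling n r → Labelling n r
  override xs g f i = if does (i ∈? xs) then g i else f i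

  override-∈ : ∀ {xs} g f {i} → i ∈ xs → override xs g f i ≡ g i
  override-∈ {xs} g f {i} i∈ with i ∈? xs
  ... | yes _ = ≡.refl
  ... | no i∉ = ⊥-elim (i∉ i∈)

  override-∉ : ∀ {xs} g f {i} → i ∉ xs → override xs g f i ≡ f i
  override-∉ {xs} g f {i} i∉ with i ∈? xs
  ... | yes i∈ = ⊥-elim (i∉ i∈)
  ... | no _ = ≡.refl

  override-∷ : ∀ x xs g f {i} → i ≢ x → override xs g f i ≡ override (x ∷ xs) g f i
  override-∷ x xs g f {i} i≢x = case i ∈? xs of λ where
    (yes i∈) → ≡.trans (override-∈ g f i∈) (≡.sym (override-∈ g f (there i∈)))
    (no i∉)  → ≡.trans (override-∉ g f i∉)
        (≡.sym (override-∉ {x ∷ xs} g f λ { (here i≡x) → i≢x i≡x ; (there i∈) → i∉ i∈ }))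

-- Carries a list of points to avoid over to the index set without `c`. Entries equal to `c`
-- disappear, which is why the length is only bounded.
shrink : ∀ {n} (c : Fin (suc n)) (xs : List (Fin (suc n))) →
         ∃[ ys ] length ys ℕ.≤ length xs × (∀ j → punchIn c j ∈ xs → j ∈ ys)
shrink c [] = [] , z≤n , λ _ ()
shrink c (x ∷ xs) with shrink c xs | c ≟ x
... | ys , le , sub | yes ≡.refl = ys , ℕ.m≤n⇒m≤1+n le , λ where
  j (here e)  → ⊥-elim (punchInᵢ≢i c j e)
  j (there e) → sub j e
... | ys , le , sub | no c≢x = punchOut c≢x ∷ ys , s≤s le , λ where
  j (here ≡.refl) → here (≡.sym (punchOut-punchIn c))
  j (there e)   → there (sub j e)

-- Concatenation of walks up to equality of vertices.

module Walks {v e a} (G : Graph v e a) where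

  open Graph G
  open Setoid vertices using () renaming (trans to ≈ⱽ-trans; sym to ≈ⱽ-sym; refl to ≈ⱽ-refl)

  infixr 5 _◅≈_ _◅◅_

  _◅≈_ : ∀ {x y z} → x ≈ⱽ y → Walk y z → Walk x z
  x≈y ◅≈ stop y≈z     = stop (≈ⱽ-trans x≈y y≈z)
  x≈y ◅≈ step y~z rest = step (~-resp (≈ⱽ-sym x≈y) ≈ⱽ-refl y~z) rest

  _◅◅_ : ∀ {x y z} → Walk x y → Walk y z → Walk x z
  stop x≈y ◅◅ w      = x≈y ◅≈ w
  step x~y rest ◅◅ w = step x~y (rest ◅◅ w)

-- The source of the constant in the theorem: two supports of at most `T` points that share a point
-- occupy at most `T + N` points, and a spare Tverberg partition takes `T` more. Here `b` counts the
-- second support without the shared point.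
overlap-room : ∀ {a b n} N → a ℕ.≤ suc N → suc b ℕ.≤ suc N → 3 ℕ.* suc N ℕ.∸ 1 ℕ.≤ n →
               a ℕ.+ b ℕ.+ suc N ℕ.≤ n
overlap-room {a} {b} {n} N a≤T (s≤s b≤N) large = begin
  a ℕ.+ b ℕ.+ T    ≤⟨ ℕ.+-monoˡ-≤ T (ℕ.+-mono-≤ a≤T b≤N) ⟩
  T ℕ.+ N ℕ.+ T    ≡⟨ ≡.cong (ℕ._+ T) (ℕ.+-comm T N) ⟩
  N ℕ.+ T ℕ.+ T    ≡⟨ ℕ.+-assoc N T T ⟩
  N ℕ.+ (T ℕ.+ T)  ≡⟨ ≡.cong (λ m → N ℕ.+ (T ℕ.+ m)) (ℕ.+-identityʳ T) ⟨
  3 ℕ.* T ℕ.∸ 1    ≤⟨ large ⟩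
  n                ∎
  where
  open ℕ.≤-Reasoning
  T = suc N

-- Sarkaria's transformation.

module TverbergPartitions {c ℓ₁ ℓ₂} (ℝ : CompleteOrderedField c ℓ₁ ℓ₂) (d r : ℕ) where

  open OrderedFieldProperties ℝ
  open LinearCombinations ℝ
  open ConvexCombinations ℝ
  open Carathéodory ℝ
  open Tverberg ℝ
  open SetoidReasoning setoid hiding (stop)

  -- The number of parts is `suc r` from here on, so `suc dimension` is the Tverberg number.
  dimension : ℕ
  dimension = suc d ℕ.* r

  lift : Point d → Fin (suc d) → Carrier
  lift p zero    = 1#
  lift p (suc k) = p k

  -- Sarkaria's vectors (p , 1) ⊗ v l, where v zero = (-1 , … , -1) and v (suc j)
  -- is the j-th unit vector, so that the only linear dependence of the v l is
  -- that they sum to zero.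
  tensor : Point d → Fin (suc r) → Fin dimension → Carrier
  tensor p l κ = let k , j = remQuot r κ in lift p k * (δ l (suc j) - δ l zero)

  ∑-tensor : ∀ p κ → ∑ (λ l → tensor p l κ) ≈ 0#
  ∑-tensor p κ = let k , j = remQuot r κ in begin
    ∑ (λ l → lift p k * (δ l (suc j) - δ l zero))
      ≈⟨ ∑-*ˡ _ _ ⟩
    lift p k * ∑ (λ l → δ l (suc j) - δ l zero)
      ≈⟨ *-congˡ (∑-cong (λ l → trans (sym (*-identityˡ _))
          (solve 3 (λ o a b → o :* (a :- b) := o :* a :+ (:- o) :* b) refl 1# _ _))) ⟩
    lift p k * ∑ (λ l → 1# * δ l (suc j) + - 1# * δ l zero)
      ≈⟨ *-congˡ (trans (∑-linear 1# (- 1#) _ _) (+-cong (*-congˡ (column (suc j))) (*-congˡ (column zero)))) ⟩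
    lift p k * (1# * 1# + - 1# * 1#)
      ≈⟨ solve 2 (λ a o → a :* (o :* o :+ (:- o) :* o) := a :- a) refl _ 1# ⟩
    lift p k - lift p k
      ≈⟨ -‿inverseʳ _ ⟩
    0# ∎
    where
    δ-sym : ∀ {n} (i j : Fin n) → δ i j ≈ δ j i
    δ-sym i j = case i ≟ j of λ where
      (yes ≡.refl) → refl
      (no i≢j)     → trans (δ-≢ i≢j) (sym (δ-≢ (i≢j ∘ ≡.sym)))

    column : ∀ j → ∑ (λ l → δ l j) ≈ 1#
    column j = trans (∑-cong (λ l → δ-sym l j)) (∑δ≈1 j)

  -- By Sarkaria's transformation, such weights witness a Tverberg partition
  -- into the fibres of f.
  record Balanced {n} (a : Fin n → Point d) (f : Labelling n (suc r))
      (w : Fin n → Carrier) : Set (ℓ₁ ⊔ ℓ₂) where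
    constructor balanced
    field
      nonneg   : ∀ i → 0# ≤ w i
      positive : 0# < ∑ w
      vanishes : ∀ κ → comb w (λ i → tensor (a i) (f i)) κ ≈ 0#

  -- A label enters the balance only through a vector multiplied by the weight of its point, so
  -- points of weight zero may take any label.
  balanced-agree : ∀ {n} {a : Fin n → Point d} {f g w} → (∀ i → w i ≈ 0# ⊎ f i ≡ g i) →
                   Balanced a f w → Balanced a g w
  balanced-agree {a = a} {f} {g} {w} agree (balanced 0≤w 0<∑w eqs) = balanced 0≤w 0<∑w
      λ κ → trans (∑-cong (λ i → same i κ)) (eqs κ)
    where
    same : ∀ i κ → w i * tensor (a i) (g i) κ ≈ w i * tensor (a i) (f i) κ
    same i κ with agree i
    ... | inj₁ wᵢ≈0 = trans (trans (*-congʳ wᵢ≈0) (zeroˡ _)) (sym (trans (*-congʳ wᵢ≈0) (zeroˡ _)))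
    ... | inj₂ e = *-congˡ (reflexive (≡.cong (λ l → tensor (a i) l κ) (≡.sym e)))

  balanced-support : ∀ {n} {a : Fin n → Point d} {f w} → Balanced a f w →
    ∃[ v ] Balanced a f v × ∃[ A ] length A ℕ.≤ suc dimension × (∀ i → i ∉ A → v i ≈ 0#)
  balanced-support {a = a} {f} {w} (balanced 0≤w 0<∑w eqs) =
    let v , 0≤v , ∑v , comb-v , A = carathéodory (λ i → tensor (a i) (f i)) w 0≤w
    in v , balanced 0≤v (<-respʳ-≈ (sym ∑v) 0<∑w) (λ κ → trans (comb-v κ) (eqs κ)) , A

  -- For empty `C` this is Tverberg's theorem: each point is a colour, whose vectors belong to the
  -- `suc r` possible labels and sum to zero. Otherwise the head of `C` is deleted from the index
  -- set and put back with weight zero and an arbitrary label.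
  tverberg-avoiding : ∀ {n} (a : Fin n → Point d) (C : List (Fin n)) → length C ℕ.+ suc dimension ℕ.≤ n →
    ∃[ f ] ∃[ w ] Balanced a f w × (∀ i → i ∈ C → w i ≈ 0#)
  tverberg-avoiding a [] le =
    let f , w , (0≤w , ∑w≈1) , eqs = colourful-carathéodory le (λ i → tensor (a i)) (λ i → ∑-tensor (a i))
    in f , w , balanced 0≤w (<-respʳ-≈ (sym ∑w≈1) 0<1) eqs , λ _ ()
  tverberg-avoiding {suc n} a (x ∷ C) (s≤s le) with shrink x C
  ... | C′ , shorter , covered with tverberg-avoiding (a ∘ punchIn x) C′ (ℕ.≤-trans (ℕ.+-monoˡ-≤ _ shorter) le)
  ...   | f , w , balanced 0≤w 0<∑w eqs , off =
    g , v , balanced (extend-nonneg x 0≤w) (<-respʳ-≈ (sym (∑-extend x w)) 0<∑w) balance , off′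
    where
    g = insertAt f x zero
    v = insertAt w x 0#

    balance : ∀ κ → comb v (λ i → tensor (a i) (g i)) κ ≈ 0#
    balance κ = begin
      comb v (λ i → tensor (a i) (g i)) κ
        ≈⟨ comb-extend x w (λ i → tensor (a i) (g i)) κ ⟩
      comb w (λ j → tensor (a (punchIn x j)) (g (punchIn x j))) κ
        ≈⟨ ∑-cong (λ j → *-congˡ
            (reflexive (≡.cong (λ l → tensor (a (punchIn x j)) l κ) (insertAt-punchIn f x zero j)))) ⟩
      comb w (λ j → tensor (a (punchIn x j)) (f j)) κ
        ≈⟨ eqs κ ⟩
      0# ∎

    off′ : ∀ i → i ∈ x ∷ C → v i ≈ 0#
    off′ i i∈ with x ≟ i
    off′ i i∈          | yes ≡.refl = reflexive (insertAt-lookup w x 0#)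
    off′ i (here i≡x)  | no x≢i = ⊥-elim (x≢i (≡.sym i≡x))
    off′ i (there i∈C) | no x≢i = ≡.subst (λ i → v i ≈ 0#) (punchIn-punchOut x≢i)
      (trans (reflexive (insertAt-punchIn w x 0# _))
             (off _ (covered _ (≡.subst (_∈ C) (≡.sym (punchIn-punchOut x≢i)) i∈C))))

  mass : ∀ {n} → Labelling n (suc r) → (Fin n → Carrier) → Fin (suc r) → Fin n → Carrier
  mass f w j i = w i * δ (f i) j

  -- As `lift` starts with `1#`, the coordinate `zero` is the total weight of part `j`, and the
  -- others form its unnormalised centroid.
  moment : ∀ {n} → (Fin n → Point d) → Labelling n (suc r) → (Fin n → Carrier) →
           Fin (suc r) → Fin (suc d) → Carrier
  moment a f w j k = ∑ λ i → mass f w j i * lift (a i) k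

  -- The factor `δ l (suc j) - δ l zero` counts label `suc j` positively and label `zero`
  -- negatively, so every coordinate compares a part with part `zero`.
  comb-tensor : ∀ {n} (a : Fin n → Point d) f w κ → let k , j = remQuot r κ in
                comb w (λ i → tensor (a i) (f i)) κ ≈ moment a f w (suc j) k - moment a f w zero k
  comb-tensor a f w κ = let k , j = remQuot r κ in begin
    ∑ (λ i → w i * (lift (a i) k * (δ (f i) (suc j) - δ (f i) zero)))
      ≈⟨ ∑-cong (λ i → trans (sym (*-identityˡ _)) (solve 5 (λ o w l x y →
           o :* (w :* (l :* (x :- y))) := o :* (w :* x :* l) :+ (:- o) :* (w :* y :* l)) refl 1# (w i) _ _ _)) ⟩
    ∑ (λ i → 1# * (mass f w (suc j) i * lift (a i) k) + - 1# * (mass f w zero i * lift (a i) k))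
      ≈⟨ ∑-linear 1# (- 1#) _ _ ⟩
    1# * moment a f w (suc j) k + - 1# * moment a f w zero k
      ≈⟨ solve 3 (λ o x y → o :* x :+ (:- o) :* y := o :* (x :- y)) refl 1# _ _ ⟩
    1# * (moment a f w (suc j) k - moment a f w zero k)
      ≈⟨ *-identityˡ _ ⟩
    moment a f w (suc j) k - moment a f w zero k ∎

  moment-zero : ∀ {n} (a : Fin n → Point d) f w j → moment a f w j zero ≈ ∑ (mass f w j)
  moment-zero a f w j = ∑-cong (λ i → *-identityʳ _)

  mass-nonneg : ∀ {n} (f : Labelling n (suc r)) {w} → (∀ i → 0# ≤ w i) → ∀ j i → 0# ≤ mass f w j i
  mass-nonneg f 0≤w j i = *-nonneg (0≤w i) (δ-nonneg (f i) j)

  ∑-mass : ∀ {n} (f : Labelling n (suc r)) w → ∑ (λ j → ∑ (mass f w j)) ≈ ∑ w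
  ∑-mass f w = trans (∑-swap _) (∑-cong (λ i → trans (∑-*ˡ (w i) _) (trans (*-congˡ (∑δ≈1 (f i))) (*-identityʳ _))))

  -- Balanced weights as witnesses of Tverberg partitions.

  module _ {n} (S : PointSet d n) where

    open Labellings {n} {suc r}

    moments-equal : ∀ {f w} → Balanced (point S) f w → ∀ j k →
        moment (point S) f w j k ≈ moment (point S) f w zero k
    moments-equal _ zero k = refl
    moments-equal {f} {w} (balanced _ _ eqs) (suc j) k = x-y≈0⇒x≈y (begin
      M (suc j) k - M zero k
        ≈⟨ reflexive (≡.cong (λ (k , j) → M (suc j) k - M zero k) (remQuot-combine k j)) ⟨
      M (suc (proj₂ kj)) (proj₁ kj) - M zero (proj₁ kj)
        ≈⟨ comb-tensor (point S) f w (combine k j) ⟨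
      comb w (λ i → tensor (point S i) (f i)) (combine k j)
        ≈⟨ eqs (combine k j) ⟩
      0# ∎)
      where
      M = moment (point S) f w
      kj = remQuot r (combine k j)

    -- Equal moments give all parts the same total weight `s` and the same unnormalised centroid. If
    -- `s` were zero, so would be `∑ w`, the sum over the parts; hence `s` is positive, and dividing
    -- by it yields the common point.
    balanced⇒conv : ∀ {f w} → Balanced (point S) f w → ∃[ q ] ∀ j → InConv S (fibre f j) q
    balanced⇒conv {f} {w} B@(balanced 0≤w 0<∑w _) = (λ k → μ * M zero (suc k)) , λ j →
      (λ i → μ * mass f w j i) ,
      (λ i → *-nonneg (inj₁ 0<μ) (mass-nonneg f 0≤w j i)) ,
      (λ i i∉ → trans (*-congˡ (trans (*-congˡ (δ-≢ (i∉ ∘ ∈-fibre⁺ {f}))) (zeroʳ _))) (zeroʳ μ)) ,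
      trans (reflexive (≡.sym (∑≡sum _)))
          (trans (∑-*ˡ μ _) (trans (*-congˡ (same-mass j)) (trans (*-comm μ _) s*μ≈1))) ,
      λ k → trans (reflexive (≡.sym (∑≡sum _))) (begin
        ∑ (λ i → μ * mass f w j i * point S i k)    ≈⟨ ∑-cong (λ i → *-assoc _ _ _) ⟩
        ∑ (λ i → μ * (mass f w j i * point S i k))  ≈⟨ ∑-*ˡ μ _ ⟩
        μ * M j (suc k)                             ≈⟨ *-congˡ (moments-equal B j (suc k)) ⟩
        μ * M zero (suc k)                          ∎)
      where
      M = moment (point S) f w
      s = ∑ (mass f w zero)

      same-mass : ∀ j → ∑ (mass f w j) ≈ s
      same-mass j = trans (sym (moment-zero (point S) f w j))
        (trans (moments-equal B j zero) (moment-zero (point S) f w zero))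

      0<s : 0# < s
      0<s with 0# <? s
      ... | yes 0<s = 0<s
      ... | no s≯0 = ⊥-elim (0<⇒≉0 0<∑w (trans (sym (∑-mass f w)) (∑-zero (λ j → trans (same-mass j) s≈0))))
        where
        s≈0 : s ≈ 0#
        s≈0 = ≤-antisym (≮⇒≥ s≯0) (∑-nonneg (mass-nonneg f 0≤w zero))

      scale = positive-inverse 0<s
      μ = proj₁ scale
      0<μ = proj₁ (proj₂ scale)
      s*μ≈1 = proj₂ (proj₂ scale)

    conv-onto : ∀ {f : Labelling n (suc r)} {q} → (∀ j → InConv S (fibre f j) q) → Onto f
    conv-onto {f} conv j with any? (λ i → f i ≟ j) | conv j
    ... | yes hit | _ = hit
    ... | no miss | w , _ , off , ∑w≈1 , _ = ⊥-elim (0<⇒≉0 0<1 (trans (sym ∑w≈1) (trans (reflexive (≡.sym (∑≡sum _)))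
          (∑-zero (λ i → off i (λ i∈ → miss (i , ∈-fibre⁻ {f} i∈)))))))

    tverberg⇒balanced : (P : Partition n (suc r)) → IsTverberg S P → ∃[ w ] Balanced (point S) (label P) w
    tverberg⇒balanced P (q , conv) = w , balanced 0≤w 0<∑w balance
      where
      f = label P
      W : Fin (suc r) → Fin n → Carrier
      W j = proj₁ (conv j)
      -- Each point takes its weight from the witness of its own part. Every part then has weight
      -- one, so the total is the number of parts; `Balanced` asks only for a positive sum.
      w = λ i → W (f i) i

      0≤w : ∀ i → 0# ≤ w i
      0≤w i = proj₁ (proj₂ (conv (f i))) i

      mass≈W : ∀ j i → mass f w j i ≈ W j i
      mass≈W j i = case f i ≟ j of λ where
        (yes ≡.refl) → trans (*-congˡ (δ-≡ (f i))) (*-identityʳ _)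
        (no fi≢j) → trans (*-congˡ (δ-≢ fi≢j)) (trans (zeroʳ _)
          (sym (proj₁ (proj₂ (proj₂ (conv j))) i (λ i∈ → fi≢j (label⁺ P i∈)))))

      ∑-mass≈1 : ∀ j → ∑ (mass f w j) ≈ 1#
      ∑-mass≈1 j = trans (∑-cong (mass≈W j)) (trans (reflexive (∑≡sum _)) (proj₁ (proj₂ (proj₂ (proj₂ (conv j))))))

      0<∑w : 0# < ∑ w
      0<∑w = <-respʳ-≈ (∑-mass f w) (<-≤-trans (<-respʳ-≈ (sym (∑-mass≈1 zero)) 0<1)
        (term≤∑ (λ j → ∑-nonneg (mass-nonneg f 0≤w j)) zero))

      moments : ∀ j k → moment (point S) f w j k ≈ lift q k
      moments j zero = trans (moment-zero (point S) f w j) (∑-mass≈1 j)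
      moments j (suc k) = trans (∑-cong (λ i → *-congʳ (mass≈W j i)))
        (trans (reflexive (∑≡sum _)) (proj₂ (proj₂ (proj₂ (proj₂ (conv j)))) k))

      balance : ∀ κ → comb w (λ i → tensor (point S i) (f i)) κ ≈ 0#
      balance κ = let k , j = remQuot r κ in trans (comb-tensor (point S) f w κ)
        (trans (+-cong (moments (suc j) k) (-‿cong (moments zero k))) (-‿inverseʳ _))

    -- Walks in the Tverberg graph.

    open Graph (tverbergGraph S (suc r))
    open Walks (tverbergGraph S (suc r))

    onto : ∀ {f w} → Balanced (point S) f w → Onto f
    onto B = conv-onto (proj₂ (balanced⇒conv B))

    vertex : ∀ {f w} → Balanced (point S) f w → Vertex
    vertex {f} B = fibres f (onto B) , balanced⇒conv B

    stay : ∀ {f g v w} (B : Balanced (point S) f v) (B′ : Balanced (point S) g w) →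
           f ≗ g → Walk (vertex B) (vertex B′)
    stay B B′ f≗g = stop {x = vertex B} {vertex B′} (fibres-cong (onto B) (onto B′) f≗g)

    relabel : ∀ {f g v w} (B : Balanced (point S) f v) (B′ : Balanced (point S) g w) x →
              (∀ i → i ≢ x → f i ≡ g i) → Walk (vertex B) (vertex B′)
    relabel {f} {g} B B′ x f≡g = case f x ≟ g x of λ where
      -- With equal labels at `x` the two vertices coincide and no edge joins them.
      (yes e) → stay B B′ (λ i → case i ≟ x of λ { (yes ≡.refl) → e ; (no i≢x) → f≡g i i≢x })
      (no ne) → step {x = vertex B} {vertex B′} {vertex B′} (distance-relabel (onto B) (onto B′) x f≡g ne)
                  (stay B′ B′ (λ _ → ≡.refl))

    -- Points of weight zero are moved one at a time.
    walk : ∀ {f g v w} (B : Balanced (point S) f v) (B′ : Balanced (point S) g w) →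
           (∀ i → v i ≈ 0# ⊎ f i ≡ g i) → Walk (vertex B) (vertex B′)
    walk {f} {g} {v} B B′ agree = along (allFin n) ◅◅ stay (mixed (allFin n)) B′
        (λ i → override-∈ g f (∈-allFin i))
      where
      open DecMembership (_≟_ {n}) using (_∈?_)

      -- All intermediate labellings share the weights `v`: by `agree`, a label changes only where
      -- `v` vanishes.
      mixed : ∀ xs → Balanced (point S) (override xs g f) v
      mixed xs = balanced-agree (λ i → case i ∈? xs of λ where
        (yes i∈) → [ inj₁ , (λ e → inj₂ (≡.trans e (≡.sym (override-∈ g f i∈)))) ]′ (agree i)
        (no i∉)  → inj₂ (≡.sym (override-∉ g f i∉))) B

      along : ∀ xs → Walk (vertex B) (vertex (mixed xs))
      along [] = stay B (mixed []) (λ _ → ≡.refl)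
      along (x ∷ xs) = along xs ◅◅ relabel (mixed xs) (mixed (x ∷ xs)) x (λ i i≢x → override-∷ x xs g f i≢x)

    connect : 3 ℕ.* suc dimension ℕ.∸ 1 ℕ.≤ n →
              ∀ {f g v w} (B : Balanced (point S) f v) (B′ : Balanced (point S) g w)
                  → Walk (vertex B) (vertex B′)
    connect large {f} {g} B₀ B₀′ with balanced-support B₀ | balanced-support B₀′
    ... | v , B , A , ∣A∣≤ , off-A | w , B′ , A′ , ∣A′∣≤ , off-A′ =
      -- Passing to a small support changes the weights but not the labelling, so the two outer
      -- walks only exchange witnesses.
      walk B₀ B (λ _ → inj₂ ≡.refl) ◅◅ middle ◅◅ walk B′ B₀′ (λ _ → inj₂ ≡.refl)
      where
      open DecMembership (_≟_ {n}) using (_∈?_)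

      middle : Walk (vertex B) (vertex B′)
      middle with Any.any? (_∈? A′) A
      ... | no disjoint = walk B Bₕ v-agree ◅◅ walk Bₕ B′ w-agree
        where
        -- Keeping `f` on `A` preserves the balance of `v`. Since `A′` avoids `A`, `h` agrees with
        -- `g` on `A′`, so `w` balances it too.
        h = override A f g

        v-agree : ∀ i → v i ≈ 0# ⊎ f i ≡ h i
        v-agree i = case i ∈? A of λ where
          (yes i∈) → inj₂ (≡.sym (override-∈ f g i∈))
          (no i∉)  → inj₁ (off-A i i∉)

        w-agree : ∀ i → w i ≈ 0# ⊎ h i ≡ g i
        w-agree i = case i ∈? A of λ where
          (yes i∈) → inj₁ (off-A′ i (λ i∈A′ → disjoint (lose i∈ i∈A′)))
          (no i∉)  → inj₂ (override-∉ f g i∉)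

        Bₕ : Balanced (point S) h w
        Bₕ = balanced-agree (λ i → [ inj₁ , inj₂ ∘ ≡.sym ]′ (w-agree i)) B′
      ... | yes meet = walk B B₁ f-agree ◅◅ walk B₁ B₂ f′-agree ◅◅ walk B₂ B′ g′-agree
        where
        common = find meet
        split = ∈-∃++ (proj₂ (proj₂ common))
        ys = proj₁ split
        zs = proj₁ (proj₂ split)
        -- The common point is already in `A`, so one occurrence of it is cut out of `A′`. This
        -- saves the one entry that `room` depends on.
        C = A ++ ys ++ zs

        A′⊆C : ∀ {i} → i ∈ A′ → i ∈ C
        A′⊆C {i} i∈ with ∈-++⁻ ys (≡.subst (i ∈_) (proj₂ (proj₂ split)) i∈)
        ... | inj₁ i∈ys = ∈-++⁺ʳ A (∈-++⁺ˡ i∈ys)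
        ... | inj₂ (here ≡.refl) = ∈-++⁺ˡ (proj₁ (proj₂ common))
        ... | inj₂ (there i∈zs) = ∈-++⁺ʳ A (∈-++⁺ʳ ys i∈zs)

        room : length C ℕ.+ suc dimension ℕ.≤ n
        room = ≡.subst (λ m → m ℕ.+ T ℕ.≤ n) (≡.sym (length-++ A)) (overlap-room dimension ∣A∣≤ rest large)
          where
          T = suc dimension

          rest : suc (length (ys ++ zs)) ℕ.≤ T
          rest = ≡.subst (ℕ._≤ T) (≡.trans (≡.cong length (proj₂ (proj₂ split))) (length-++-∷ ys)) ∣A′∣≤
            where
            length-++-∷ : ∀ (ys : List (Fin n)) {x zs} → length (ys ++ x ∷ zs) ≡ suc (length (ys ++ zs))
            length-++-∷ [] = ≡.refl
            length-++-∷ (_ ∷ ys) = ≡.cong suc (length-++-∷ ys)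

        spare = tverberg-avoiding (point S) C room
        t = proj₁ spare
        u = proj₁ (proj₂ spare)
        Bₜ = proj₁ (proj₂ (proj₂ spare))
        off-C = proj₂ (proj₂ (proj₂ spare))

        -- Outside `C`, where the spare weights `u` live, both labellings follow `t`; on `C` they
        -- follow `f` and `g`. The three walks are witnessed by `v`, `u` and `w` in turn.
        f′ = override C f t
        g′ = override C g t

        f-agree : ∀ i → v i ≈ 0# ⊎ f i ≡ f′ i
        f-agree i = case i ∈? A of λ where
          (yes i∈) → inj₂ (≡.sym (override-∈ f t (∈-++⁺ˡ i∈)))
          (no i∉)  → inj₁ (off-A i i∉)

        f′-agree : ∀ i → u i ≈ 0# ⊎ f′ i ≡ g′ i
        f′-agree i = case i ∈? C of λ where
          (yes i∈) → inj₁ (off-C i i∈)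
          (no i∉)  → inj₂ (≡.trans (override-∉ f t i∉) (≡.sym (override-∉ g t i∉)))

        g′-agree : ∀ i → w i ≈ 0# ⊎ g′ i ≡ g i
        g′-agree i = case i ∈? A′ of λ where
          (yes i∈) → inj₂ (override-∈ g t (A′⊆C i∈))
          (no i∉)  → inj₁ (off-A′ i i∉)

        B₁ : Balanced (point S) f′ u
        B₁ = balanced-agree (λ i → case i ∈? C of λ where
          (yes i∈) → inj₁ (off-C i i∈)
          (no i∉)  → inj₂ (≡.sym (override-∉ f t i∉))) Bₜ

        B₂ : Balanced (point S) g′ w
        B₂ = balanced-agree (λ i → [ inj₁ , inj₂ ∘ ≡.sym ]′ (g′-agree i)) B′

    connected : 3 ℕ.* suc dimension ℕ.∸ 1 ℕ.≤ n → Connected (tverbergGraph S (suc r))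
    connected large = vertex₀ , λ (P , tP) (Q , tQ) →
      let _ , B  = tverberg⇒balanced P tP
          _ , B′ = tverberg⇒balanced Q tQ
      in _◅≈_ {P , tP} {vertex B} (fibres-label P (onto B))
           (connect large B B′ ◅◅ stop {x = vertex B′} {Q , tQ} (swap (fibres-label Q (onto B′))))
      where
      -- Nonemptiness of the graph is Tverberg's theorem, with no point to avoid.
      vertex₀ : Vertex
      vertex₀ =
        let _ , _ , B , _ = tverberg-avoiding (point S) []
              (ℕ.≤-trans (ℕ.≤-trans (ℕ.m≤m+n _ _) (ℕ.m≤n+m _ dimension)) large)
        in vertex B

open import Data.Nat using (ℕ; _+_; _*_; _∸_; _≤_)

theorem1p3 : ∀ {c ℓ₁ ℓ₂} (ℝ : CompleteOrderedField c ℓ₁ ℓ₂)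
    (r d : ℕ) → 1 ≤ r → 1 ≤ d →
    (n : ℕ) (S : Tverberg.PointSet ℝ d n) → 3 * Tv d r ∸ 1 ≤ n →
    Connected (Tverberg.tverbergGraph ℝ S r)
theorem1p3 ℝ (suc r) d _ _ n S large =
  TverbergPartitions.connected ℝ d r S (≡.subst (λ m → 3 * m ∸ 1 ≤ n) Tv≡ large)
  where
  Tv≡ : Tv d (suc r) ≡ suc (suc d * r)
  Tv≡ = ≡.trans (ℕ.+-comm ((d + 1) * r) 1) (≡.cong (λ m → suc (m * r)) (ℕ.+-comm d 1))
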